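{- For the admission control to minimize rejections problem described in the context, in the unweighted case where every request has cost $1$, there is a randomized preemptive online algorithm that is $O(\log m\log c)$-competitive, i.e. the expected number of requests it rejects is at most $O(\log m\log c)\cdot C_{OPT}$.
   Context: Admission control to minimize rejections: a directed graph $G=(V,E)$ with $|E|=m$ is given, each edge $e$ having an integer capacity $c_e>0$; let $c=\max_{e\in E}c_e$. Requests $r_1,r_2,\ldots$ arrive one at a time; each request is a simple path in $G$ (here each has cost $1$). A feasible solution is a set of accepted requests such that for every edge $e$ the number of accepted requests whose paths contain $e$ is at most $c_e$; its cost is the number of rejected requests. $C_{OPT}$ is the minimum cost of a feasible solution for the whole sequence. The online algorithm must decide upon arrival of each request whether to accept or reject it, keeping the set of currently accepted requests feasible at all times; it may preempt (reject a previously accepted request) but may never accept a request once rejected. An algorithm is $\beta$-competitive if the expected cost of its rejections is at most $\beta C_{OPT}$. -}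

module Defs where

open import Data.Nat using (ℕ; zero; suc; _+_; _*_; _≤_; _⊔_)
open import Data.Nat.Logarithm using (⌈log₂_⌉)
open import Data.Bool using (Bool; true; false; _∧_; if_then_else_)
open import Data.Fin using (Fin; zero; suc)
open import Data.Fin.Properties using (_≟_)
open import Data.List using (List; []; _∷_; map; allFin; foldr)
open import Data.Bool.ListAction using (any)
open import Data.List.Relation.Unary.Linked using (Linked)
open import Data.List.Relation.Unary.Unique.Propositional using (Unique)
open import Data.Vec using (Vec; []; _∷_; _∷ʳ_; lookup)
open import Data.Product using (Σ; _×_; _,_)
open import Data.Unit using (⊤)
open import Data.Integer using (+_)
open import Data.Rational using (ℚ; _/_; 0ℚ) renaming (_+_ to _+ℚ_; _*_ to _*ℚ_)
open import Relation.Binary.PropositionalEquality using (_≡_; _≢_)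
open import Relation.Nullary.Decidable using (⌊_⌋)

record Instance : Set where
  field
    n      : ℕ
    m      : ℕ
    src    : Fin m → Fin n
    tgt    : Fin m → Fin n
    noLoop : ∀ e → src e ≢ tgt e
    simple : ∀ e e′ → src e ≡ src e′ → tgt e ≡ tgt e′ → e ≡ e′
    cap    : Fin m → ℕ
    capPos : ∀ e → 1 ≤ cap e
open Instance public

maxCap : Instance → ℕ
maxCap I = foldr _⊔_ 0 (map (cap I) (allFin (m I)))

Path : Instance → Set
Path I = List (Fin (m I))

verts : (I : Instance) → Path I → List (Fin (n I))
verts I []       = []
verts I (e ∷ es) = src I e ∷ map (tgt I) (e ∷ es)

IsSimplePath : (I : Instance) → Path I → Set
IsSimplePath I p = (p ≢ []) × Linked (λ e e′ → tgt I e ≡ src I e′) p × Unique (verts I p)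

uses : (I : Instance) → Fin (m I) → Path I → Bool
uses I e p = any (λ e′ → ⌊ e ≟ e′ ⌋) p

load : (I : Instance) {k : ℕ} → Vec Bool k → Vec (Path I) k → Fin (m I) → ℕ
load I []       []       e = 0
load I (b ∷ bs) (p ∷ ps) e = (if b ∧ uses I e p then 1 else 0) + load I bs ps e

Feasible : (I : Instance) {k : ℕ} → Vec Bool k → Vec (Path I) k → Set
Feasible I acc ps = ∀ e → load I acc ps e ≤ cap I e

rejected : {k : ℕ} → Vec Bool k → ℕ
rejected []           = 0
rejected (true ∷ bs)  = rejected bs
rejected (false ∷ bs) = suc (rejected bs)

_⊆ᵇ_ : {k : ℕ} → Vec Bool k → Vec Bool k → Set
_⊆ᵇ_ {k} a b = ∀ (j : Fin k) → lookup a j ≡ true → lookup b j ≡ true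

-- A randomized online algorithm for instance I (known in advance).
-- It has an arbitrary internal state.  On the arrival of request number i,
-- given its state, the current accepted flags of the i previous requests,
-- the previous requests and the new request, it draws r uniformly from
-- Fin (suc k) (k chosen by the algorithm) and, depending on r, outputs
-- a new state, new flags for the previous requests, and a flag for the new one.
record Alg (I : Instance) : Set₁ where
  field
    State : Set
    init  : State
    step  : (i : ℕ) → State → Vec Bool i → Vec (Path I) i → Path I →
            Σ ℕ (λ k → Fin (suc k) → State × Vec Bool i × Bool)
open Alg public

LegalFrom : {I : Instance} (A : Alg I) (i : ℕ) → State A → Vec Bool i → Vec (Path I) i → List (Path I) → Set
LegalFrom A i s acc ps [] = ⊤
LegalFrom {I} A i s acc ps (p ∷ rs) with step A i s acc ps p
... | k , f = ∀ (r : Fin (suc k)) → Go (f r)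
  where
  Go : State A × Vec Bool i × Bool → Set
  Go (s′ , acc′ , b) = (acc′ ⊆ᵇ acc) × Feasible I (acc′ ∷ʳ b) (ps ∷ʳ p)
                       × LegalFrom A (suc i) s′ (acc′ ∷ʳ b) (ps ∷ʳ p) rs

Legal : {I : Instance} (A : Alg I) → List (Path I) → Set
Legal A rs = LegalFrom A 0 (init A) [] [] rs

toℚ : ℕ → ℚ
toℚ k = (+ k) / 1

sumFin : (k : ℕ) → (Fin k → ℚ) → ℚ
sumFin zero    f = 0ℚ
sumFin (suc k) f = f zero +ℚ sumFin k (λ j → f (suc j))

ExpRejFrom : {I : Instance} (A : Alg I) (i : ℕ) → State A → Vec Bool i → Vec (Path I) i → List (Path I) → ℚ
ExpRejFrom A i s acc ps [] = toℚ (rejected acc)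
ExpRejFrom A i s acc ps (p ∷ rs) with step A i s acc ps p
... | k , f = sumFin (suc k) (λ r → Go (f r)) *ℚ ((+ 1) / suc k)
  where
  Go : State A × Vec Bool i × Bool → ℚ
  Go (s′ , acc′ , b) = ExpRejFrom A (suc i) s′ (acc′ ∷ʳ b) (ps ∷ʳ p) rs

ExpRej : {I : Instance} (A : Alg I) → List (Path I) → ℚ
ExpRej A rs = ExpRejFrom A 0 (init A) [] [] rs

-- the factor log m · log c (each logarithm taken as 1 + ⌈log₂ ·⌉ so it is ≥ 1)
logFactor : Instance → ℕ
logFactor I = suc ⌈log₂ m I ⌉ * suc ⌈log₂ maxCap I ⌉

{-# OPTIONS --safe #-}

-- Every request j carries a deterministic weight h_j, standing for the rejected fraction
-- h_j / C of a fractional solution, and draws one uniform r_j ∈ {0, …, C - 1} on arrival;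
-- it is preempted as soon as r_j < L h_j, where C = 1 + max capacity and L = Θ(log m).
-- A request with L h_j ≥ C is certainly gone; the others are "in play".
--
-- If accepting a new request would violate the fractional covering constraint of some edge,
-- the weights (shifted by 1) of the requests in play on that edge are multiplied by
-- 1 + 1/n, n being the excess, and the new request is rejected.  The optimum rejects at
-- least n of the requests involved, so the product of h_j + 1 over the requests rejected by
-- the optimum doubles; this product is at most (2C)^OPT, so there are O(log c) OPT such
-- augmentations.  Each adds O(C) to the total weight, i.e. O(L) expected preemptions.
--
-- If a new request is admitted fractionally but does not fit, some edge has too many
-- survivors.  By Markov's inequality applied to 2^(number of survivors) this has probability
-- at most 1/m per edge, and it is only possible once the edge has received at least as many
-- requests as its capacity, which is the case for at most OPT later requests.
module Submission where

open import Defs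
open import Data.Nat using (ℕ; _*_)
open import Data.List using (List; length)
open import Data.List.Relation.Unary.All using (All)
open import Data.Vec using (Vec; fromList)
open import Data.Bool using (Bool)
open import Data.Product using (Σ; _×_; _,_)

module Rejections where

  open import Data.Nat
  open import Data.Nat.Properties
  open import Algebra.Properties.CommutativeSemigroup *-commutativeSemigroup
    using () renaming (x∙yz≈y∙xz to *-swap; interchange to *-interchange)
  open import Algebra.Properties.CommutativeSemigroup +-commutativeSemigroup
    using () renaming (interchange to +-interchange)
  open import Algebra.Properties.Semiring.Sum +-*-semiring
    using (sum; sum-cong-≗; ∑-distrib-+; ∑-comm; *-distribˡ-sum; *-distribʳ-sum)
  open import Data.Bool using (true; false; if_then_else_; _∧_; not; T)
  import Data.Bool.Properties as Bool
  open import Data.Empty using (⊥-elim)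
  open import Data.Fin using (Fin; zero; suc; toℕ)
  open import Data.Fin.Properties using (any?; all?; toℕ<n; ¬∀⟶∃¬)
  import Data.Integer as ℤ
  import Data.Integer.Properties as ℤ
  open import Data.List using ([]; _∷_; foldr)
  open import Data.List.Membership.Propositional using (_∈_)
  open import Data.List.Membership.Propositional.Properties using (∈-map⁺; ∈-allFin)
  open import Data.List.Relation.Unary.Any using (here; there)
  import Data.Nat.Coprimality as Coprimality
  open import Data.Nat.DivMod using (m≡m%n+[m/n]*n; m%n<n; m/n*n≤m; m/n≤m)
  open import Data.Nat.Induction using (<-rec)
  open import Data.Nat.Logarithm
  open import Data.Nat.Tactic.RingSolver using (solve-∀)
  open import Data.Product using (proj₁; proj₂)
  open import Data.Rational as ℚ using (ℚ; mkℚ; 1ℚ)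
  import Data.Rational.Properties as ℚ
  open import Data.Unit using (tt)
  open import Data.Vec using ([]; _∷_; _∷ʳ_; zipWith; toList)
  open import Data.Vec.Relation.Unary.All as Vec using ([]; _∷_)
  open import Function using (Equivalence)
  open import Relation.Binary.PropositionalEquality
  open import Relation.Nullary using (Dec; yes; no; ¬_)
  open import Relation.Nullary.Decidable using (map′; _×-dec_)

  -- Arithmetic and finite sums

  -- Bernoulli's inequality 1 + x/n ≤ (1 + 1/n)^x, cleared of denominators.
  bernoulli : ∀ n x → (n + x) * n ^ x ≤ n * suc n ^ x
  bernoulli n zero    = ≤-reflexive (cong (_* 1) (+-identityʳ n))
  bernoulli n (suc x) = begin
    (n + suc x) * (n * n ^ x)       ≤⟨ m≤m+n _ (x * n ^ x) ⟩
    (n + suc x) * (n * n ^ x) + x * n ^ x ≡⟨ lemma n x (n ^ x) ⟩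
    suc n * ((n + x) * n ^ x)       ≤⟨ *-monoʳ-≤ (suc n) (bernoulli n x) ⟩
    suc n * (n * suc n ^ x)         ≡⟨ *-swap (suc n) n (suc n ^ x) ⟩
    n * (suc n * suc n ^ x)         ∎
    where
    open ≤-Reasoning
    lemma : ∀ n x y → (n + suc x) * (n * y) + x * y ≡ suc n * ((n + x) * y)
    lemma = solve-∀

  -- Bernoulli's 1 + x/n is at least 2 once n ≤ x. This is what doubles the potential at an
  -- augmentation.
  2*n^x≤[1+n]^x : ∀ {n x} .{{_ : NonZero n}} → n ≤ x → 2 * n ^ x ≤ suc n ^ x
  2*n^x≤[1+n]^x {n} {x} n≤x = *-cancelˡ-≤ n (begin
    n * (2 * n ^ x)   ≡⟨ lemma n (n ^ x) ⟩
    (n + n) * n ^ x   ≤⟨ *-monoˡ-≤ (n ^ x) (+-monoʳ-≤ n n≤x) ⟩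
    (n + x) * n ^ x   ≤⟨ bernoulli n x ⟩
    n * suc n ^ x     ∎)
    where
    open ≤-Reasoning
    lemma : ∀ n y → n * (2 * y) ≡ (n + n) * y
    lemma = solve-∀

  -- Each block of `suc n` factors 1 + 1/n contributes one doubling. The tail bound for crowded
  -- edges applies this with `suc n` equal to `D`.
  2^q*n^x≤[1+n]^x : ∀ {n x} q .{{_ : NonZero n}} → q * suc n ≤ x → 2 ^ q * n ^ x ≤ suc n ^ x
  2^q*n^x≤[1+n]^x {n} {x} zero _ = ≤-trans (≤-reflexive (*-identityˡ _)) (^-monoˡ-≤ x (n≤1+n n))
  2^q*n^x≤[1+n]^x {n} {x} (suc q) le with m≤n⇒∃[o]m+o≡n (m+n≤o⇒m≤o (suc n) le)
  ... | y , refl = begin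
    2 * 2 ^ q * n ^ (suc n + y)            ≡⟨ cong (2 * 2 ^ q *_) (^-distribˡ-+-* n (suc n) y) ⟩
    2 * 2 ^ q * (n ^ suc n * n ^ y)        ≡⟨ lemma (2 ^ q) (n ^ suc n) (n ^ y) ⟩
    2 * n ^ suc n * (2 ^ q * n ^ y)        ≤⟨ *-mono-≤ (2*n^x≤[1+n]^x (n≤1+n n)) (2^q*n^x≤[1+n]^x q (+-cancelˡ-≤ (suc n) _ _ le)) ⟩
    suc n ^ suc n * suc n ^ y              ≡⟨ ^-distribˡ-+-* (suc n) (suc n) y ⟨
    suc n ^ (suc n + y)                    ∎
    where
    open ≤-Reasoning
    lemma : ∀ a b c → 2 * a * (b * c) ≡ 2 * b * (a * c)
    lemma = solve-∀

  -- 1 − a/d ≤ (1 − 1/d)^a for d = n + 1, cleared of denominators.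
  [d∸a]*d^a≤d*[d∸1]^a : ∀ n a → (suc n ∸ a) * suc n ^ a ≤ suc n * n ^ a
  [d∸a]*d^a≤d*[d∸1]^a n zero    = ≤-refl
  [d∸a]*d^a≤d*[d∸1]^a n (suc a) = begin
    (n ∸ a) * (suc n * suc n ^ a)      ≡⟨ *-assoc (n ∸ a) (suc n) _ ⟨
    (n ∸ a) * suc n * suc n ^ a        ≤⟨ *-monoˡ-≤ (suc n ^ a) key ⟩
    n * (suc n ∸ a) * suc n ^ a        ≡⟨ *-assoc n (suc n ∸ a) _ ⟩
    n * ((suc n ∸ a) * suc n ^ a)      ≤⟨ *-monoʳ-≤ n ([d∸a]*d^a≤d*[d∸1]^a n a) ⟩
    n * (suc n * n ^ a)                ≡⟨ *-swap n (suc n) (n ^ a) ⟩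
    suc n * (n * n ^ a)                ∎
    where
    open ≤-Reasoning
    -- In fractions, (1 - a/d)(1 - 1/d) exceeds 1 - (a + 1)/d by a/d². For a > n, truncated
    -- subtraction makes the smaller side zero.
    key : (n ∸ a) * suc n ≤ n * (suc n ∸ a)
    key with a ≤? n
    ... | yes a≤n = begin
      (n ∸ a) * suc n        ≡⟨ *-suc (n ∸ a) n ⟩
      (n ∸ a) + (n ∸ a) * n  ≤⟨ +-mono-≤ (m∸n≤m n a) (≤-reflexive (*-comm (n ∸ a) n)) ⟩
      n + n * (n ∸ a)        ≡⟨ *-suc n (n ∸ a) ⟨
      n * suc (n ∸ a)        ≡⟨ cong (n *_) (+-∸-assoc 1 a≤n) ⟨
      n * (suc n ∸ a)        ∎
    ... | no a≰n = ≤-trans (≤-reflexive (cong (_* suc n) (m≤n⇒m∸n≡0 (<⇒≤ (≰⇒> a≰n))))) z≤n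

  -- Strong induction by halving: n ≤ 2 ⌈n/2⌉, and for n ≥ 2 passing to ⌈n/2⌉ lowers the rounded
  -- logarithm by one.
  n≤2^⌈log₂n⌉ : ∀ n → n ≤ 2 ^ ⌈log₂ n ⌉
  n≤2^⌈log₂n⌉ = <-rec _ go
    where
    open ≤-Reasoning
    go : ∀ n → (∀ {k} → k < n → k ≤ 2 ^ ⌈log₂ k ⌉) → n ≤ 2 ^ ⌈log₂ n ⌉
    go 0 _ = z≤n
    go 1 _ = s≤s z≤n
    go n@(suc (suc k)) rec = begin
      n                                ≡⟨ ⌊n/2⌋+⌈n/2⌉≡n n ⟨
      ⌊ n /2⌋ + ⌈ n /2⌉                ≤⟨ +-monoˡ-≤ _ (⌊n/2⌋≤⌈n/2⌉ n) ⟩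
      ⌈ n /2⌉ + ⌈ n /2⌉                ≤⟨ +-mono-≤ half half ⟩
      2 ^ (⌈log₂ n ⌉ ∸ 1) + 2 ^ (⌈log₂ n ⌉ ∸ 1)  ≡⟨ cong (2 ^ (⌈log₂ n ⌉ ∸ 1) +_) (+-identityʳ _) ⟨
      2 ^ suc (⌈log₂ n ⌉ ∸ 1)          ≡⟨ cong (2 ^_) (m+[n∸m]≡n {1} (⌈log₂⌉-mono-≤ {2} {n} (s≤s (s≤s z≤n)))) ⟩
      2 ^ ⌈log₂ n ⌉                    ∎
      where
      half : ⌈ n /2⌉ ≤ 2 ^ (⌈log₂ n ⌉ ∸ 1)
      half = subst (λ z → ⌈ n /2⌉ ≤ 2 ^ z) (⌈log₂⌈n/2⌉⌉≡⌈log₂n⌉∸1 n) (rec (⌈n/2⌉<n k))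

  -- Sums over indices, over outcomes of the draws, and over paired vectors.

  ⟦_⟧ : Bool → ℕ
  ⟦ b ⟧ = if b then 1 else 0

  sum-mono : ∀ {k} {f g : Fin k → ℕ} → (∀ j → f j ≤ g j) → sum f ≤ sum g
  sum-mono {zero}  f≤g = z≤n
  sum-mono {suc k} f≤g = +-mono-≤ (f≤g zero) (sum-mono (λ j → f≤g (suc j)))

  sum-const : ∀ k a → sum {k} (λ _ → a) ≡ k * a
  sum-const zero    a = refl
  sum-const (suc k) a = cong (a +_) (sum-const k a)

  term≤sum : ∀ {k} (f : Fin k → ℕ) j → f j ≤ sum f
  term≤sum f zero    = m≤m+n _ _
  term≤sum f (suc j) = m≤n⇒m≤o+n (f zero) (term≤sum (λ i → f (suc i)) j)

  suc-≤ᵇ : ∀ a b → (suc a ≤ᵇ suc b) ≡ (a ≤ᵇ b)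
  suc-≤ᵇ zero    b = refl
  suc-≤ᵇ (suc a) b = refl

  sum-below : ∀ k a → sum {k} (λ r → ⟦ not (a ≤ᵇ toℕ r) ⟧) ≤ a
  sum-below zero    a       = z≤n
  sum-below (suc k) zero    = ≤-reflexive (trans (sum-const k 0) (*-zeroʳ k))
  sum-below (suc k) (suc a) = s≤s (≤-trans (≤-reflexive (sum-cong-≗ {k} λ r → cong (λ b → ⟦ not b ⟧) (suc-≤ᵇ a (toℕ r)))) (sum-below k a))

  -- The `k ∸ a` draws at or above the threshold count twice. With a = `h * L` this is the factor
  -- that one request contributes to the moment of 2 ^ `alive`.
  sum-above : ∀ k a → sum {k} (λ r → 2 ^ ⟦ a ≤ᵇ toℕ r ⟧) ≤ k + (k ∸ a)
  sum-above zero    a       = z≤n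
  sum-above (suc k) zero    = ≤-reflexive (trans (cong (2 +_) (sum-const k 2)) (lemma k))
    where
    lemma : ∀ k → 2 + k * 2 ≡ suc k + suc k
    lemma = solve-∀
  sum-above (suc k) (suc a) = s≤s (≤-trans (≤-reflexive (sum-cong-≗ {k} λ r → cong (λ b → 2 ^ ⟦ b ⟧) (suc-≤ᵇ a (toℕ r)))) (sum-above k a))

  module _ (C : ℕ) where
    -- This is C ^ i times the expectation over i independent uniform draws; leaving out the
    -- division keeps all the probability theory in ℕ.
    ∑ᵛ : (i : ℕ) → (Vec (Fin C) i → ℕ) → ℕ
    ∑ᵛ zero    F = F []
    ∑ᵛ (suc i) F = sum {C} (λ r → ∑ᵛ i (λ R → F (r ∷ R)))

  module _ {C : ℕ} where
    ∑ᵛ-mono : ∀ i {F G : Vec (Fin C) i → ℕ} → (∀ R → F R ≤ G R) → ∑ᵛ C i F ≤ ∑ᵛ C i G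
    ∑ᵛ-mono zero    F≤G = F≤G []
    ∑ᵛ-mono (suc i) F≤G = sum-mono (λ r → ∑ᵛ-mono i (λ R → F≤G (r ∷ R)))

    ∑ᵛ-cong : ∀ i {F G : Vec (Fin C) i → ℕ} → (∀ R → F R ≡ G R) → ∑ᵛ C i F ≡ ∑ᵛ C i G
    ∑ᵛ-cong zero    F≡G = F≡G []
    ∑ᵛ-cong (suc i) F≡G = sum-cong-≗ {C} (λ r → ∑ᵛ-cong i (λ R → F≡G (r ∷ R)))

    ∑ᵛ-distrib-+ : ∀ i (F G : Vec (Fin C) i → ℕ) → ∑ᵛ C i (λ R → F R + G R) ≡ ∑ᵛ C i F + ∑ᵛ C i G
    ∑ᵛ-distrib-+ zero    F G = refl
    ∑ᵛ-distrib-+ (suc i) F G = trans (sum-cong-≗ {C} (λ r → ∑ᵛ-distrib-+ i _ _)) (∑-distrib-+ {C} _ _)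

    ∑ᵛ-distribˡ-* : ∀ i a (F : Vec (Fin C) i → ℕ) → ∑ᵛ C i (λ R → a * F R) ≡ a * ∑ᵛ C i F
    ∑ᵛ-distribˡ-* zero    a F = refl
    ∑ᵛ-distribˡ-* (suc i) a F = trans (sum-cong-≗ {C} (λ r → ∑ᵛ-distribˡ-* i a _)) (sym (*-distribˡ-sum {C} a _))

    ∑ᵛ-const : ∀ i a → ∑ᵛ C i (λ _ → a) ≡ C ^ i * a
    ∑ᵛ-const zero    a = sym (+-identityʳ a)
    ∑ᵛ-const (suc i) a = trans (sum-cong-≗ {C} (λ r → ∑ᵛ-const i a)) (trans (sum-const C _) (sym (*-assoc C (C ^ i) a)))

    ∑ᵛ-sum : ∀ i {k} (F : Fin k → Vec (Fin C) i → ℕ) → ∑ᵛ C i (λ R → sum (λ j → F j R)) ≡ sum (λ j → ∑ᵛ C i (F j))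
    ∑ᵛ-sum zero    F = refl
    ∑ᵛ-sum (suc i) {k} F = trans (sum-cong-≗ {C} (λ r → ∑ᵛ-sum i {k} (λ j R → F j (r ∷ R)))) (∑-comm {C} {k} _)

    -- `∑ᵛ` recurses on the oldest draw, whereas an arrival appends a new one at the end.
    ∑ᵛ-∷ʳ : ∀ i (F : Vec (Fin C) (suc i) → ℕ) → ∑ᵛ C (suc i) F ≡ ∑ᵛ C i (λ R → sum (λ r → F (R ∷ʳ r)))
    ∑ᵛ-∷ʳ zero    F = refl
    ∑ᵛ-∷ʳ (suc i) F = sum-cong-≗ {C} (λ r → ∑ᵛ-∷ʳ i (λ R → F (r ∷ R)))

  Σ₂ : ∀ {A B : Set} {i} → (A → B → ℕ) → Vec A i → Vec B i → ℕ
  Σ₂ f []       []       = 0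
  Σ₂ f (x ∷ xs) (y ∷ ys) = f x y + Σ₂ f xs ys

  module _ {A B : Set} where
    private variable
      i : ℕ
      f g : A → B → ℕ

    Σ₂-mono : (∀ x y → f x y ≤ g x y) → (xs : Vec A i) (ys : Vec B i) → Σ₂ f xs ys ≤ Σ₂ g xs ys
    Σ₂-mono f≤g []       []       = z≤n
    Σ₂-mono f≤g (x ∷ xs) (y ∷ ys) = +-mono-≤ (f≤g x y) (Σ₂-mono f≤g xs ys)

    Σ₂-+ : (f g : A → B → ℕ) (xs : Vec A i) (ys : Vec B i) →
           Σ₂ (λ x y → f x y + g x y) xs ys ≡ Σ₂ f xs ys + Σ₂ g xs ys
    Σ₂-+ f g []       []       = refl
    Σ₂-+ f g (x ∷ xs) (y ∷ ys) = trans (cong (f x y + g x y +_) (Σ₂-+ f g xs ys)) (+-interchange (f x y) (g x y) _ _)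

    Σ₂-* : ∀ a (f : A → B → ℕ) (xs : Vec A i) (ys : Vec B i) →
           Σ₂ (λ x y → a * f x y) xs ys ≡ a * Σ₂ f xs ys
    Σ₂-* a f []       []       = sym (*-zeroʳ a)
    Σ₂-* a f (x ∷ xs) (y ∷ ys) = trans (cong (a * f x y +_) (Σ₂-* a f xs ys)) (sym (*-distribˡ-+ a (f x y) _))

    Σ₂-∷ʳ : ∀ (f : A → B → ℕ) (xs : Vec A i) (ys : Vec B i) x y →
            Σ₂ f (xs ∷ʳ x) (ys ∷ʳ y) ≡ Σ₂ f xs ys + f x y
    Σ₂-∷ʳ f []       []       x y = +-identityʳ (f x y)
    Σ₂-∷ʳ f (x′ ∷ xs) (y′ ∷ ys) x y = trans (cong (f x′ y′ +_) (Σ₂-∷ʳ f xs ys x y)) (sym (+-assoc (f x′ y′) _ _))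

    Σ₂-zipWith : ∀ (f : A → B → ℕ) (u : A → B → A) (xs : Vec A i) (ys : Vec B i) →
                 Σ₂ f (zipWith u xs ys) ys ≡ Σ₂ (λ x y → f (u x y) y) xs ys
    Σ₂-zipWith f u []       []       = refl
    Σ₂-zipWith f u (x ∷ xs) (y ∷ ys) = cong (f (u x y) y +_) (Σ₂-zipWith f u xs ys)

  -- The fractional algorithm

  module Algorithm (I : Instance) (c ℓ : ℕ) where

    -- The factor 2 in `L` keeps every weight in play below C/2, as `capped-count` needs, and
    -- offsets the 2 in `D` = 2C in `rarely-crowded`.
    C L : ℕ
    C = suc c
    L = 2 * suc ℓ

    -- The request is on e and in play, i.e. not certain to have been preempted.
    member : Fin (m I) → ℕ → Path I → Bool
    member e h p = uses I e p ∧ (h * L <ᵇ C)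

    count weight : ∀ {i} → Fin (m I) → Vec ℕ i → Vec (Path I) i → ℕ
    count  e = Σ₂ (λ h p → ⟦ member e h p ⟧)
    weight e = Σ₂ (λ h p → if member e h p then h else 0)

    -- Admitting p with weight 0 would break C |X| ≤ C cap e + Σ_{X} h, where X is the set of
    -- requests in play on e; `Balanced` below is this covering constraint for all edges.
    record Overloaded {i} (w : Vec ℕ i) (ps : Vec (Path I) i) (p : Path I) : Set where
      constructor overload
      field
        edge     : Fin (m I)
        used     : uses I edge p ≡ true
        exceeded : C * cap I edge + weight edge w ps < C * suc (count edge w ps)

    overloaded? : ∀ {i} (w : Vec ℕ i) ps p → Dec (Overloaded w ps p)
    overloaded? w ps p = map′ (λ (e , used , exceeded) → overload e used exceeded)
      (λ (overload e used exceeded) → e , used , exceeded)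
      (any? λ e → (uses I e p Bool.≟ true) ×-dec (_ <? _))

    -- Multiplies h + 1 by 1 + 1 / (q + 1), rounded up to stay within the integers.
    raise : Fin (m I) → ℕ → ℕ → Path I → ℕ
    raise e q h p = if member e h p then h + suc (h / suc q) else h

    module _ {i} {w : Vec ℕ i} {ps : Vec (Path I) i} {p : Path I} where
      -- The excess counts the new request too, so it is `suc (count e w ps ∸ cap I e)`, matching
      -- the `suc q` in `raise`. Taking the decision as an argument lets proofs split on it without
      -- unfolding `overloaded?`.
      bump : Dec (Overloaded w ps p) → ℕ → Path I → ℕ
      bump (yes (overload e _ _)) = raise e (count e w ps ∸ cap I e)
      bump (no _)                 = λ h _ → h

      -- Weight C exceeds every threshold: it marks a request that is rejected on arrival.
      fresh : Dec (Overloaded w ps p) → ℕ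
      fresh (yes _) = C
      fresh (no _)  = 0

      augmented : Dec (Overloaded w ps p) → ℕ
      augmented (yes _) = 1
      augmented (no _)  = 0

      bumped : Dec (Overloaded w ps p) → Vec ℕ i
      bumped d = zipWith (bump d) w ps

      next : Dec (Overloaded w ps p) → Vec ℕ (suc i)
      next d = bumped d ∷ʳ fresh d

    augmentations : ∀ {i} → Vec ℕ i → Vec (Path I) i → List (Path I) → ℕ
    augmentations w ps []       = 0
    augmentations w ps (p ∷ rs) = augmented d + augmentations (next d) (ps ∷ʳ p) rs
      where d = overloaded? w ps p

    -- Invariance of the covering constraint and of the weight bound.

    Balanced : ∀ {i} → Vec ℕ i → Vec (Path I) i → Set
    Balanced w ps = ∀ e → C * count e w ps ≤ C * cap I e + weight e w ps

    in-play : ∀ h → (h * L <ᵇ C) ≡ true → h * L < C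
    in-play h eq = <ᵇ⇒< (h * L) C (subst T (sym eq) tt)

    out-of-play : ∀ h → (h * L <ᵇ C) ≡ false → C ≤ h * L
    out-of-play h eq = ≮⇒≥ (λ lt → subst T eq (<⇒<ᵇ lt))

    2h≤hL : ∀ h → 2 * h ≤ h * L
    2h≤hL h = ≤-trans (m≤m+n (2 * h) (2 * h * ℓ)) (≤-reflexive (lemma h ℓ))
      where
      lemma : ∀ h l → 2 * h + 2 * h * l ≡ h * (2 * suc l)
      lemma = solve-∀

    h≤hL : ∀ h → h ≤ h * L
    h≤hL h = ≤-trans (m≤m+n h _) (2h≤hL h)

    raise-≥ : ∀ e q h p → h ≤ raise e q h p
    raise-≥ e q h p with member e h p
    ... | true  = m≤m+n h _
    ... | false = ≤-refl

    bump-≥ : ∀ {i} {w : Vec ℕ i} {ps p} (d : Dec (Overloaded w ps p)) h p′ → h ≤ bump d h p′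
    bump-≥ (yes _) h p′ = raise-≥ _ _ h p′
    bump-≥ (no _)  h p′ = ≤-refl

    -- A request leaving play lowers the left-hand side of the covering constraint by C and the
    -- right-hand side by at most its former weight, which is less than C.
    member-trade : ∀ e {h h′} p → h ≤ h′ →
      C * ⟦ member e h′ p ⟧ + (if member e h p then h else 0) ≤ C * ⟦ member e h p ⟧ + (if member e h′ p then h′ else 0)
    member-trade e {h} {h′} p h≤h′ with uses I e p
    ... | false = ≤-refl
    ... | true with h * L <ᵇ C in eq | h′ * L <ᵇ C in eq′
    ...   | true  | true  = +-monoʳ-≤ (C * 1) h≤h′
    ...   | false | false = ≤-refl
    ...   | true  | false = begin
      C * 0 + h  ≡⟨ cong (_+ h) (*-zeroʳ C) ⟩
      h          ≤⟨ h≤hL h ⟩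
      h * L      ≤⟨ <⇒≤ (in-play h eq) ⟩
      C          ≡⟨ *-identityʳ C ⟨
      C * 1      ≡⟨ +-identityʳ (C * 1) ⟨
      C * 1 + 0  ∎
      where open ≤-Reasoning
    ...   | false | true  = ⊥-elim (<⇒≱ (in-play h′ eq′) (≤-trans (out-of-play h eq) (*-monoˡ-≤ L h≤h′)))

    trade : ∀ {i} e (w : Vec ℕ i) ps (u : ℕ → Path I → ℕ) → (∀ h p → h ≤ u h p) →
      C * count e (zipWith u w ps) ps + weight e w ps ≤ C * count e w ps + weight e (zipWith u w ps) ps
    trade e w ps u h≤u = begin
      C * count e (zipWith u w ps) ps + weight e w ps
        ≡⟨ cong₂ _+_ (trans (cong (C *_) (Σ₂-zipWith _ u w ps)) (sym (Σ₂-* C _ w ps))) refl ⟩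
      Σ₂ (λ h p → C * ⟦ member e (u h p) p ⟧) w ps + weight e w ps
        ≡⟨ Σ₂-+ _ _ w ps ⟨
      Σ₂ (λ h p → C * ⟦ member e (u h p) p ⟧ + (if member e h p then h else 0)) w ps
        ≤⟨ Σ₂-mono (λ h p → member-trade e p (h≤u h p)) w ps ⟩
      Σ₂ (λ h p → C * ⟦ member e h p ⟧ + (if member e (u h p) p then u h p else 0)) w ps
        ≡⟨ Σ₂-+ _ _ w ps ⟩
      Σ₂ (λ h p → C * ⟦ member e h p ⟧) w ps + Σ₂ (λ h p → (if member e (u h p) p then u h p else 0)) w ps
        ≡⟨ cong₂ _+_ (Σ₂-* C _ w ps) (sym (Σ₂-zipWith _ u w ps)) ⟩
      C * count e w ps + weight e (zipWith u w ps) ps ∎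
      where open ≤-Reasoning

    member-C : ∀ e p → member e C p ≡ false
    member-C e p with C * L <ᵇ C in eq
    ... | false = Bool.∧-zeroʳ (uses I e p)
    ... | true  = ⊥-elim (<⇒≱ (in-play C eq) (h≤hL C))

    balanced-next : ∀ {i} {w : Vec ℕ i} {ps p} (d : Dec (Overloaded w ps p)) →
      Balanced w ps → Balanced (next d) (ps ∷ʳ p)
    balanced-next {w = w} {ps} {p} d bal e = begin
      C * count e (next d) (ps ∷ʳ p)
        ≡⟨ cong (C *_) (Σ₂-∷ʳ _ (bumped d) ps (fresh d) p) ⟩
      C * (count e (bumped d) ps + ⟦ member e (fresh d) p ⟧)
        -- The old weight is added to both sides so that `trade`, which is free of subtraction, can
        -- be applied.
        ≤⟨ +-cancelʳ-≤ (weight e w ps) _ _ main ⟩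
      C * cap I e + weight e (bumped d) ps
        ≤⟨ +-monoʳ-≤ (C * cap I e) (m≤m+n (weight e (bumped d) ps) _) ⟩
      C * cap I e + (weight e (bumped d) ps + (if member e (fresh d) p then fresh d else 0))
        ≡⟨ cong (C * cap I e +_) (Σ₂-∷ʳ _ (bumped d) ps (fresh d) p) ⟨
      C * cap I e + weight e (next d) (ps ∷ʳ p) ∎
      where
      open ≤-Reasoning
      extra : (d : Dec (Overloaded w ps p)) →
        C * (count e w ps + ⟦ member e (fresh d) p ⟧) ≤ C * cap I e + weight e w ps
      extra (yes _) rewrite member-C e p | +-identityʳ (count e w ps) = bal e
      extra (no ¬over) with uses I e p in eq
      ... | false rewrite +-identityʳ (count e w ps) = bal e
      ... | true  rewrite +-comm (count e w ps) 1 = ≮⇒≥ (λ lt → ¬over (overload e eq lt))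
      rearrange : ∀ a b c d → a * (b + c) + d ≡ a * b + d + a * c
      rearrange = solve-∀
      shuffle : ∀ a b c d → a * b + c + a * d ≡ a * (b + d) + c
      shuffle = solve-∀
      swap : ∀ a b c → a + b + c ≡ a + c + b
      swap = solve-∀
      main : C * (count e (bumped d) ps + ⟦ member e (fresh d) p ⟧) + weight e w ps
           ≤ C * cap I e + weight e (bumped d) ps + weight e w ps
      main = begin
        C * (count e (bumped d) ps + ⟦ member e (fresh d) p ⟧) + weight e w ps
          ≡⟨ rearrange C (count e (bumped d) ps) _ _ ⟩
        C * count e (bumped d) ps + weight e w ps + C * ⟦ member e (fresh d) p ⟧
          ≤⟨ +-monoˡ-≤ _ (trade e w ps (bump d) (bump-≥ d)) ⟩
        C * count e w ps + weight e (bumped d) ps + C * ⟦ member e (fresh d) p ⟧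
          ≡⟨ shuffle C (count e w ps) (weight e (bumped d) ps) _ ⟩
        C * (count e w ps + ⟦ member e (fresh d) p ⟧) + weight e (bumped d) ps
          ≤⟨ +-monoˡ-≤ _ (extra d) ⟩
        C * cap I e + weight e w ps + weight e (bumped d) ps
          ≡⟨ swap (C * cap I e) (weight e w ps) _ ⟩
        C * cap I e + weight e (bumped d) ps + weight e w ps ∎

    Bounded : ∀ {i} → Vec ℕ i → Set
    Bounded = Vec.All (λ h → suc h ≤ 2 * C)

    -- Only a weight in play is raised. Such an h satisfies h + 1 ≤ C, and raising at most doubles h
    -- + 1.
    raise-bounded : ∀ e q h p → suc h ≤ 2 * C → suc (raise e q h p) ≤ 2 * C
    raise-bounded e q h p b with uses I e p | h * L <ᵇ C in eq
    ... | false | _     = b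
    ... | true  | false = b
    ... | true  | true  = begin
      suc (h + suc (h / suc q))  ≡⟨ +-suc (suc h) (h / suc q) ⟩
      suc (suc h) + h / suc q    ≤⟨ +-monoʳ-≤ (suc (suc h)) (m/n≤m h (suc q)) ⟩
      suc (suc h) + h            ≡⟨ lemma h ⟩
      2 * suc h                  ≤⟨ *-monoʳ-≤ 2 (≤-<-trans (h≤hL h) (in-play h eq)) ⟩
      2 * C                      ∎
      where
      open ≤-Reasoning
      lemma : ∀ h → suc (suc h) + h ≡ 2 * suc h
      lemma = solve-∀

    All-∷ʳ : ∀ {i} {P : ℕ → Set} {xs : Vec ℕ i} {x} → Vec.All P xs → P x → Vec.All P (xs ∷ʳ x)
    All-∷ʳ []         px = px ∷ []
    All-∷ʳ (py ∷ pys) px = py ∷ All-∷ʳ pys px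

    All-zipWith : ∀ {i} {A : Set} {P : ℕ → Set} {u : ℕ → A → ℕ} → (∀ h p → P h → P (u h p)) →
      {w : Vec ℕ i} → Vec.All P w → (ps : Vec A i) → Vec.All P (zipWith u w ps)
    All-zipWith f []         []       = []
    All-zipWith f (ph ∷ phs) (p ∷ ps) = f _ p ph ∷ All-zipWith f phs ps

    2≤1+C : 2 ≤ suc C
    2≤1+C = s≤s (s≤s z≤n)

    bounded-next : ∀ {i} {w : Vec ℕ i} {ps p} (d : Dec (Overloaded w ps p)) → Bounded w → Bounded (next d)
    bounded-next {ps = ps} d bw = All-∷ʳ (All-zipWith (step-bound d) bw ps) (new d)
      where
      step-bound : ∀ d h p → suc h ≤ 2 * C → suc (bump d h p) ≤ 2 * C
      step-bound (yes _) h p = raise-bounded _ _ h p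
      step-bound (no _)  h p = λ b → b
      new : ∀ d → suc (fresh d) ≤ 2 * C
      new (yes _) = +-mono-≤ {1} {C} {C} (s≤s z≤n) (≤-reflexive (sym (+-identityʳ C)))
      new (no _)  = s≤s z≤n

    -- Growth of the total weight.

    total : ∀ {i} → Vec ℕ i → Vec (Path I) i → ℕ
    total = Σ₂ (λ h _ → h)

    -- Weights in play are below C/2, so the weight on e covers at most half of C times the count;
    -- the covering constraint leaves the other half to the capacity.
    capped-count : ∀ {i} (w : Vec ℕ i) ps e → Balanced w ps → count e w ps ≤ 2 * cap I e
    capped-count w ps e bal = *-cancelˡ-≤ C (+-cancelʳ-≤ (C * count e w ps) _ _ (begin
      C * count e w ps + C * count e w ps    ≤⟨ +-mono-≤ (bal e) (bal e) ⟩
      C * cap I e + weight e w ps + (C * cap I e + weight e w ps)  ≡⟨ lemma C (cap I e) (weight e w ps) ⟩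
      C * (2 * cap I e) + 2 * weight e w ps  ≤⟨ +-monoʳ-≤ (C * (2 * cap I e)) light ⟩
      C * (2 * cap I e) + C * count e w ps   ∎))
      where
      open ≤-Reasoning
      lemma : ∀ C a b → C * a + b + (C * a + b) ≡ C * (2 * a) + 2 * b
      lemma = solve-∀
      item : ∀ h p → 2 * (if member e h p then h else 0) ≤ C * ⟦ member e h p ⟧
      item h p with uses I e p | h * L <ᵇ C in eq
      ... | false | _     = z≤n
      ... | true  | false = z≤n
      ... | true  | true  = ≤-trans (2h≤hL h) (≤-trans (<⇒≤ (in-play h eq)) (≤-reflexive (sym (*-identityʳ C))))
      light : 2 * weight e w ps ≤ C * count e w ps
      light = subst₂ _≤_ (Σ₂-* 2 _ w ps) (Σ₂-* C _ w ps) (Σ₂-mono item w ps)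

    -- With ν = `suc q`, ν times the increment 1 + ⌊h/ν⌋ is at most ν + h; this is summed over the
    -- requests in play on e.
    total-raise : ∀ {i} (w : Vec ℕ i) ps e q →
      suc q * total (zipWith (raise e q) w ps) ps ≤ suc q * total w ps + (suc q * count e w ps + weight e w ps)
    total-raise w ps e q = begin
      ν * total (zipWith (raise e q) w ps) ps
        ≡⟨ cong (ν *_) (Σ₂-zipWith _ (raise e q) w ps) ⟩
      ν * Σ₂ (raise e q) w ps
        ≡⟨ Σ₂-* ν (raise e q) w ps ⟨
      Σ₂ (λ h p → ν * raise e q h p) w ps
        ≤⟨ Σ₂-mono item w ps ⟩
      Σ₂ (λ h p → ν * h + (ν * ⟦ member e h p ⟧ + (if member e h p then h else 0))) w ps
        ≡⟨ Σ₂-+ _ _ w ps ⟩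
      Σ₂ (λ h p → ν * h) w ps + Σ₂ (λ h p → ν * ⟦ member e h p ⟧ + (if member e h p then h else 0)) w ps
        ≡⟨ cong₂ _+_ (Σ₂-* ν _ w ps) (trans (Σ₂-+ _ _ w ps) (cong (_+ weight e w ps) (Σ₂-* ν _ w ps))) ⟩
      ν * total w ps + (ν * count e w ps + weight e w ps) ∎
      where
      open ≤-Reasoning
      ν = suc q
      expand : ∀ ν h x → ν * (h + suc x) ≡ ν * h + (ν * 1 + x * ν)
      expand = solve-∀
      item : ∀ h p → ν * raise e q h p ≤ ν * h + (ν * ⟦ member e h p ⟧ + (if member e h p then h else 0))
      item h p with member e h p
      ... | false = m≤m+n (ν * h) _
      ... | true  = ≤-trans (≤-reflexive (expand ν h (h / ν))) (+-monoʳ-≤ (ν * h) (+-monoʳ-≤ (ν * 1) (m/n*n≤m h ν)))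

    module _ (cap≤C : ∀ e → cap I e ≤ C) where
      -- An augmentation adds at most 2C by rounding (one unit per request in play on the edge, see
      -- `capped-count`), at most C through the quotients by the excess, and C for the newcomer
      -- rejected on arrival.
      total-next : ∀ {i} {w : Vec ℕ i} {ps p} (d : Dec (Overloaded w ps p)) → Balanced w ps →
        total (next d) (ps ∷ʳ p) ≤ total w ps + 4 * C * augmented d
      total-next {w = w} {ps} {p} d@(no _) bal = ≤-reflexive (begin-equality
        total (next d) (ps ∷ʳ p)           ≡⟨ Σ₂-∷ʳ _ (bumped d) ps 0 p ⟩
        total (bumped d) ps + 0            ≡⟨ cong (_+ 0) (Σ₂-zipWith _ (λ h _ → h) w ps) ⟩
        total w ps + 0                     ≡⟨ cong (total w ps +_) (*-zeroʳ (4 * C)) ⟨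
        total w ps + 4 * C * 0             ∎)
        where open ≤-Reasoning
      total-next {w = w} {ps} {p} d@(yes (overload e _ over)) bal = begin
        total (next d) (ps ∷ʳ p)          ≡⟨ Σ₂-∷ʳ _ (bumped d) ps C p ⟩
        total (bumped d) ps + C           ≤⟨ +-monoˡ-≤ C (*-cancelˡ-≤ ν main) ⟩
        total w ps + (2 * C + C) + C      ≡⟨ collect (total w ps) C ⟩
        total w ps + 4 * C * 1            ∎
        where
        open ≤-Reasoning
        collect : ∀ t C → t + (2 * C + C) + C ≡ t + 4 * C * 1
        collect = solve-∀
        factor : ∀ ν t C → ν * t + (ν * (2 * C) + C * ν) ≡ ν * (t + (2 * C + C))
        factor = solve-∀
        k = count e w ps
        ν = suc (k ∸ cap I e)
        -- The violated constraint says that C times the excess is larger than the weight on the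
        -- edge.
        light : weight e w ps ≤ C * ν
        light = <⇒≤ (+-cancelˡ-< (C * cap I e) _ _ (begin-strict
          C * cap I e + weight e w ps   <⟨ over ⟩
          C * suc k                     ≤⟨ *-monoʳ-≤ C (s≤s (m≤n+m∸n k (cap I e))) ⟩
          C * suc (cap I e + (k ∸ cap I e)) ≡⟨ cong (C *_) (+-suc (cap I e) _) ⟨
          C * (cap I e + ν)             ≡⟨ *-distribˡ-+ C (cap I e) ν ⟩
          C * cap I e + C * ν           ∎))
        main : ν * total (bumped d) ps ≤ ν * (total w ps + (2 * C + C))
        main = begin
          ν * total (bumped d) ps                                  ≤⟨ total-raise w ps e _ ⟩
          ν * total w ps + (ν * k + weight e w ps)                 ≤⟨ +-monoʳ-≤ (ν * total w ps) (+-mono-≤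
            (*-monoʳ-≤ ν (≤-trans (capped-count w ps e bal) (*-monoʳ-≤ 2 (cap≤C e)))) light) ⟩
          ν * total w ps + (ν * (2 * C) + C * ν)                   ≡⟨ factor ν (total w ps) C ⟩
          ν * (total w ps + (2 * C + C))                           ∎

    -- The potential over the optimum's rejections.

    potential : ∀ {i} → Vec ℕ i → Vec Bool i → ℕ
    potential []      []       = 1
    potential (h ∷ w) (o ∷ os) = (if o then 1 else suc h) * potential w os

    -- The flags are the optimum's. These are the requests whose factors in `potential` an
    -- augmentation on e multiplies.
    missed : ∀ {i} → Fin (m I) → Vec ℕ i → Vec (Path I) i → Vec Bool i → ℕ
    missed e []      []       []       = 0
    missed e (h ∷ w) (p ∷ ps) (o ∷ os) = ⟦ not o ∧ member e h p ⟧ + missed e w ps os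

    count≤missed+load : ∀ {i} e (w : Vec ℕ i) ps os → count e w ps ≤ missed e w ps os + load I os ps e
    count≤missed+load e []      []       []       = z≤n
    count≤missed+load e (h ∷ w) (p ∷ ps) (o ∷ os) = ≤-trans
      (+-mono-≤ (item o (uses I e p) (h * L <ᵇ C)) (count≤missed+load e w ps os))
      (≤-reflexive (+-interchange ⟦ not o ∧ member e h p ⟧ ⟦ o ∧ uses I e p ⟧ _ _))
      where
      item : ∀ o u b → ⟦ u ∧ b ⟧ ≤ ⟦ not o ∧ (u ∧ b) ⟧ + ⟦ o ∧ u ⟧
      item true  true  true  = ≤-refl
      item true  true  false = z≤n
      item true  false b     = z≤n
      item false true  b     = m≤m+n _ _
      item false false b     = z≤n

    potential-∷ʳ : ∀ {i} (w : Vec ℕ i) os h o → potential (w ∷ʳ h) (os ∷ʳ o) ≡ potential w os * (if o then 1 else suc h)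
    potential-∷ʳ []       []       h o = *-comm (if o then 1 else suc h) 1
    potential-∷ʳ (x ∷ w) (o′ ∷ os) h o = trans (cong ((if o′ then 1 else suc x) *_) (potential-∷ʳ w os h o)) (sym (*-assoc (if o′ then 1 else suc x) _ _))

    potential-mono : ∀ {i} (w : Vec ℕ i) (ps : Vec (Path I) i) os (u : ℕ → Path I → ℕ) → (∀ h p → h ≤ u h p) →
      potential w os ≤ potential (zipWith u w ps) os
    potential-mono []      []       []           u h≤u = ≤-refl
    potential-mono (h ∷ w) (p ∷ ps) (true ∷ os)  u h≤u = *-monoʳ-≤ 1 (potential-mono w ps os u h≤u)
    potential-mono (h ∷ w) (p ∷ ps) (false ∷ os) u h≤u = *-mono-≤ (s≤s (h≤u h p)) (potential-mono w ps os u h≤u)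

    potential-bounded : ∀ {i} {w : Vec ℕ i} os → Bounded w → potential w os ≤ (2 * C) ^ rejected os
    potential-bounded []           []       = ≤-refl
    potential-bounded (true ∷ os)  (b ∷ bs) = ≤-trans (≤-reflexive (*-identityˡ _)) (potential-bounded os bs)
    potential-bounded (false ∷ os) (b ∷ bs) = *-mono-≤ b (potential-bounded os bs)

    -- Each missed request contributes a factor of at least 1 + 1/ν with ν = `suc q`; both sides are
    -- scaled to avoid the fraction.
    potential-raise : ∀ {i} e q (w : Vec ℕ i) ps os →
      suc (suc q) ^ missed e w ps os * potential w os ≤ suc q ^ missed e w ps os * potential (zipWith (raise e q) w ps) os
    potential-raise e q []      []       []           = ≤-refl
    potential-raise e q (h ∷ w) (p ∷ ps) (true ∷ os)
      rewrite *-identityˡ (potential w os) | *-identityˡ (potential (zipWith (raise e q) w ps) os) = potential-raise e q w ps os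
    potential-raise e q (h ∷ w) (p ∷ ps) (false ∷ os) with member e h p
    ... | false = begin
      A * (suc h * Q)    ≡⟨ *-swap A (suc h) Q ⟩
      suc h * (A * Q)    ≤⟨ *-monoʳ-≤ (suc h) (potential-raise e q w ps os) ⟩
      suc h * (B * Q′)   ≡⟨ *-swap B (suc h) Q′ ⟨
      B * (suc h * Q′)   ∎
      where
      open ≤-Reasoning
      A = suc (suc q) ^ missed e w ps os
      B = suc q ^ missed e w ps os
      Q = potential w os
      Q′ = potential (zipWith (raise e q) w ps) os
    ... | true = begin
      suc ν * A * (suc h * Q)        ≡⟨ *-interchange (suc ν) A (suc h) Q ⟩
      suc ν * suc h * (A * Q)        ≤⟨ *-mono-≤ step-bound (potential-raise e q w ps os) ⟩
      ν * suc h′ * (B * Q′)          ≡⟨ *-interchange ν B (suc h′) Q′ ⟨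
      ν * B * (suc h′ * Q′)          ∎
      where
      open ≤-Reasoning
      ν = suc q
      h′ = h + suc (h / ν)
      A = suc ν ^ missed e w ps os
      B = ν ^ missed e w ps os
      Q = potential w os
      Q′ = potential (zipWith (raise e q) w ps) os
      expand : ∀ ν h x → ν * suc h + (ν + x * ν) ≡ ν * suc (h + suc x)
      expand = solve-∀
      -- Because `raise` rounds up, the increment 1 + ⌊h/ν⌋ is at least (h + 1)/ν.
      ceil : suc h ≤ ν + (h / ν) * ν
      ceil = subst (λ z → suc z ≤ ν + (h / ν) * ν) (sym (m≡m%n+[m/n]*n h ν)) (+-monoˡ-≤ _ (m%n<n h ν))
      step-bound : suc ν * suc h ≤ ν * suc h′
      step-bound = begin
        suc h + ν * suc h              ≡⟨ +-comm (suc h) _ ⟩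
        ν * suc h + suc h              ≤⟨ +-monoʳ-≤ (ν * suc h) ceil ⟩
        ν * suc h + (ν + (h / ν) * ν)  ≡⟨ expand ν h (h / ν) ⟩
        ν * suc h′                     ∎

    -- At an augmentation there are two cases. If the optimum rejects the newcomer, its own factor C
    -- + 1 is at least 2. If the optimum accepts it, at least ν requests on the edge are missed, ν
    -- being the excess, and (1 + 1/ν)^ν ≥ 2.
    potential-next : ∀ {i} {w : Vec ℕ i} {ps p} (d : Dec (Overloaded w ps p)) os o →
      (∀ e → load I os ps e + ⟦ o ∧ uses I e p ⟧ ≤ cap I e) →
      2 ^ augmented d * potential w os ≤ potential (next d) (os ∷ʳ o)
    potential-next {w = w} {ps} {p} d os o feas = ≤-trans (main d o feas) (≤-reflexive (sym (potential-∷ʳ (bumped d) os (fresh d) o)))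
      where
      open ≤-Reasoning
      mono : ∀ d → potential w os ≤ potential (bumped d) os
      mono d = potential-mono w ps os (bump d) (bump-≥ d)
      main : ∀ d o → (∀ e → load I os ps e + ⟦ o ∧ uses I e p ⟧ ≤ cap I e) →
        2 ^ augmented d * potential w os ≤ potential (bumped d) os * (if o then 1 else suc (fresh d))
      main d@(no _) true  _ = ≤-trans (≤-reflexive (*-comm 1 (potential w os))) (*-monoˡ-≤ 1 (mono d))
      main d@(no _) false _ = ≤-trans (≤-reflexive (*-comm 1 (potential w os))) (*-monoˡ-≤ 1 (mono d))
      main d@(yes _) false _ = ≤-trans (≤-reflexive (*-comm 2 (potential w os))) (*-mono-≤ (mono d) 2≤1+C)
      main d@(yes (overload e used over)) true feas = ≤-trans (*-cancelˡ-≤ (ν ^ x) {{m^n≢0 ν x}} (begin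
        ν ^ x * (2 * potential w os)           ≡⟨ assoc (ν ^ x) (potential w os) ⟩
        2 * ν ^ x * potential w os             ≤⟨ *-monoˡ-≤ (potential w os) (2*n^x≤[1+n]^x ν≤x) ⟩
        suc ν ^ x * potential w os             ≤⟨ potential-raise e _ w ps os ⟩
        ν ^ x * potential (bumped d) os        ∎)) (≤-reflexive (sym (*-identityʳ _)))
        where
        assoc : ∀ a b → a * (2 * b) ≡ 2 * a * b
        assoc = solve-∀
        k = count e w ps
        ν = suc (k ∸ cap I e)
        x = missed e w ps os
        cap≤k : cap I e ≤ k
        cap≤k = s≤s⁻¹ (*-cancelˡ-< C _ _ (≤-<-trans (m≤m+n _ _) over))
        -- The accepted newcomer takes one unit of the optimum's capacity on e, so at most `cap I e`
        -- - 1 of the earlier requests there are not missed.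
        room : load I os ps e + 1 ≤ cap I e
        room = subst (λ b → load I os ps e + ⟦ b ⟧ ≤ cap I e) used (feas e)
        ν≤x : ν ≤ x
        ν≤x = +-cancelʳ-≤ (cap I e) ν x (begin
          suc (k ∸ cap I e + cap I e)   ≡⟨ cong suc (m∸n+n≡m cap≤k) ⟩
          suc k                         ≤⟨ s≤s (count≤missed+load e w ps os) ⟩
          suc (x + load I os ps e)      ≡⟨ +-suc x _ ⟨
          x + suc (load I os ps e)      ≡⟨ cong (x +_) (+-comm 1 _) ⟩
          x + (load I os ps e + 1)      ≤⟨ +-monoʳ-≤ x room ⟩
          x + cap I e                   ∎)

    rejected-∷ʳ : ∀ {i} (os : Vec Bool i) o → rejected (os ∷ʳ o) ≡ rejected os + ⟦ not o ⟧
    rejected-∷ʳ []           true  = refl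
    rejected-∷ʳ []           false = refl
    rejected-∷ʳ (true ∷ os)  o     = rejected-∷ʳ os o
    rejected-∷ʳ (false ∷ os) o     = cong suc (rejected-∷ʳ os o)

    rejected-∷ : ∀ {i} o (os : Vec Bool i) → rejected (o ∷ os) ≡ ⟦ not o ⟧ + rejected os
    rejected-∷ true  os = refl
    rejected-∷ false os = refl

    load-∷ʳ : ∀ {i} (os : Vec Bool i) ps o p e → load I (os ∷ʳ o) (ps ∷ʳ p) e ≡ load I os ps e + ⟦ o ∧ uses I e p ⟧
    load-∷ʳ []        []        o p e = +-identityʳ _
    load-∷ʳ (o′ ∷ os) (p′ ∷ ps) o p e = trans (cong (⟦ o′ ∧ uses I e p′ ⟧ +_) (load-∷ʳ os ps o p e)) (sym (+-assoc ⟦ o′ ∧ uses I e p′ ⟧ _ _))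

    -- The optimum is fixed for the whole sequence but is cut at the current time; an induction over
    -- the arrivals moves one flag at a time from future to past.
    FeasibleSplit : ∀ {i j} → Vec Bool i → Vec (Path I) i → Vec Bool j → Vec (Path I) j → Set
    FeasibleSplit past ps future rs = ∀ e → load I past ps e + load I future rs e ≤ cap I e

    shift-split : ∀ {i j} {past : Vec Bool i} {ps o p} {future : Vec Bool j} {rs} →
      FeasibleSplit past ps (o ∷ future) (p ∷ rs) → FeasibleSplit (past ∷ʳ o) (ps ∷ʳ p) future rs
    shift-split {past = past} {ps} {o} {p} feas e = ≤-trans (≤-reflexive
      (trans (cong (_+ _) (load-∷ʳ past ps o p e)) (+-assoc (load I past ps e) _ _))) (feas e)

    rejected-shift : ∀ {i j} (past : Vec Bool i) o (future : Vec Bool j) →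
      rejected (past ∷ʳ o) + rejected future ≡ rejected past + rejected (o ∷ future)
    rejected-shift past o future = trans (cong (_+ rejected future) (rejected-∷ʳ past o))
      (trans (+-assoc (rejected past) _ _) (cong (rejected past +_) (sym (rejected-∷ o future))))

    -- Every augmentation still to come doubles the potential, and at the end each of its nontrivial
    -- factors is at most 2C.
    augmentations-bound : ∀ {i} {w : Vec ℕ i} {ps past} rs future → Bounded w →
      FeasibleSplit past ps future (fromList rs) →
      2 ^ augmentations w ps rs * potential w past ≤ (2 * C) ^ (rejected past + rejected future)
    augmentations-bound {w = w} {past = past} [] [] bw feas = begin
      1 * potential w past                ≡⟨ *-identityˡ _ ⟩
      potential w past                    ≤⟨ potential-bounded past bw ⟩
      (2 * C) ^ rejected past             ≡⟨ cong ((2 * C) ^_) (+-identityʳ (rejected past)) ⟨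
      (2 * C) ^ (rejected past + 0)       ∎
      where open ≤-Reasoning
    augmentations-bound {w = w} {ps} {past} (p ∷ rs) (o ∷ future) bw feas = begin
      2 ^ (augmented d + N) * potential w past           ≡⟨ cong (_* potential w past) (^-distribˡ-+-* 2 (augmented d) N) ⟩
      2 ^ augmented d * 2 ^ N * potential w past         ≡⟨ swap (2 ^ augmented d) (2 ^ N) (potential w past) ⟩
      2 ^ N * (2 ^ augmented d * potential w past)       ≤⟨ *-monoʳ-≤ (2 ^ N) (potential-next d past o
        (λ e → ≤-trans (+-monoʳ-≤ (load I past ps e) (m≤m+n _ _)) (feas e))) ⟩
      2 ^ N * potential (next d) (past ∷ʳ o)             ≤⟨ augmentations-bound rs future (bounded-next d bw) (shift-split {past = past} {future = future} feas) ⟩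
      (2 * C) ^ (rejected (past ∷ʳ o) + rejected future) ≡⟨ cong ((2 * C) ^_) (rejected-shift past o future) ⟩
      (2 * C) ^ (rejected past + rejected (o ∷ future))  ∎
      where
      open ≤-Reasoning
      swap : ∀ a b c → a * b * c ≡ b * (a * c)
      swap = solve-∀
      d = overloaded? w ps p
      N = augmentations (next d) (ps ∷ʳ p) rs

  -- Random thresholds

  ^-distribʳ-* : ∀ a b x → (a * b) ^ x ≡ a ^ x * b ^ x
  ^-distribʳ-* a b zero    = refl
  ^-distribʳ-* a b (suc x) = trans (cong (a * b *_) (^-distribʳ-* a b x)) (*-interchange a b (a ^ x) (b ^ x))

  module Random (I : Instance) (c ℓ : ℕ) where
    open Algorithm I c ℓ

    survives : ℕ → Fin C → Bool
    survives h r = h * L ≤ᵇ toℕ r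

    killed : ∀ {i} → Vec ℕ i → Vec (Fin C) i → ℕ
    killed = Σ₂ (λ h r → ⟦ not (survives h r) ⟧)

    -- A request that outlasts its threshold is counted even if it was rejected for lack of room.
    -- The count thus depends only on the independent draws, the weights being deterministic.
    alive : ∀ {i} → Fin (m I) → Vec ℕ i → Vec (Path I) i → Vec (Fin C) i → ℕ
    alive e []      []       []      = 0
    alive e (h ∷ w) (p ∷ ps) (r ∷ R) = ⟦ uses I e p ∧ survives h r ⟧ + alive e w ps R

    arrivals : ∀ {i} → Fin (m I) → Vec (Path I) i → ℕ
    arrivals e []       = 0
    arrivals e (p ∷ ps) = ⟦ uses I e p ⟧ + arrivals e ps

    risk : ∀ {i} → Fin (m I) → Vec (Path I) i → Path I → ℕ
    risk e ps p = ⟦ uses I e p ∧ (cap I e ≤ᵇ arrivals e ps) ⟧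

    crowded : ∀ {i} → Fin (m I) → Vec ℕ i → Vec (Path I) i → Vec (Fin C) i → ℕ
    crowded e w ps R = ⟦ cap I e ≤ᵇ alive e w ps R ⟧

    -- The edges that can make an admitted request not fit; `risk` is the deterministic part,
    -- which can be charged to the optimum.
    failure : ∀ {i} {w : Vec ℕ i} {ps p} → Dec (Overloaded w ps p) → Vec (Fin C) i → ℕ
    failure (yes _) R = 0
    failure {w = w} {ps} {p} (no _) R = sum (λ e → risk e ps p * crowded e w ps R)

    -- Expected preemptions and the tail of the number of survivors.

    expected-killed : ∀ {i} (w : Vec ℕ i) ps → C * ∑ᵛ C i (killed w) ≤ C ^ i * (L * total w ps)
    expected-killed []      []       = ≤-reflexive (trans (*-zeroʳ C) (sym (trans (+-identityʳ _) (*-zeroʳ L))))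
    expected-killed {suc i} (h ∷ w) (p ∷ ps) = begin
      C * sum {C} (λ r → ∑ᵛ C i (λ R → x r + killed w R))
        ≡⟨ cong (C *_) (sum-cong-≗ {C} λ r → trans (∑ᵛ-distrib-+ i (λ _ → x r) (killed w)) (cong (_+ K) (∑ᵛ-const i (x r)))) ⟩
      C * sum {C} (λ r → C ^ i * x r + K)
        ≡⟨ cong (C *_) (trans (∑-distrib-+ {C} (λ r → C ^ i * x r) (λ _ → K)) (cong₂ _+_ (sym (*-distribˡ-sum {C} (C ^ i) x)) (sum-const C K))) ⟩
      C * (C ^ i * sum x + C * K)
        ≤⟨ *-monoʳ-≤ C (+-mono-≤ (*-monoʳ-≤ (C ^ i) (sum-below C (h * L))) (expected-killed w ps)) ⟩
      C * (C ^ i * (h * L) + C ^ i * (L * total w ps))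
        ≡⟨ collect C (C ^ i) h L (total w ps) ⟩
      C * C ^ i * (L * (h + total w ps)) ∎
      where
      open ≤-Reasoning
      x : Fin C → ℕ
      x r = ⟦ not (survives h r) ⟧
      K = ∑ᵛ C i (killed w)
      collect : ∀ C y h L t → C * (y * (h * L) + y * (L * t)) ≡ C * y * (L * (h + t))
      collect = solve-∀

    -- C ^ i times the expectation of 2 ^ alive.
    gain : ∀ {i} → Fin (m I) → Vec ℕ i → Vec (Path I) i → ℕ
    gain e []      []       = 1
    gain e (h ∷ w) (p ∷ ps) = (if uses I e p then C + (C ∸ h * L) else C) * gain e w ps

    -- By independence the exponential moment factorises over the requests, and `sum-above` bounds
    -- each factor.
    expected-2^alive : ∀ {i} e (w : Vec ℕ i) ps → ∑ᵛ C i (λ R → 2 ^ alive e w ps R) ≤ gain e w ps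
    expected-2^alive e []      []       = ≤-refl
    expected-2^alive {suc i} e (h ∷ w) (p ∷ ps) = begin
      sum {C} (λ r → ∑ᵛ C i (λ R → 2 ^ (x r + alive e w ps R)))
        ≡⟨ sum-cong-≗ {C} (λ r → trans
             (∑ᵛ-cong i (λ R → ^-distribˡ-+-* 2 (x r) (alive e w ps R)))
             (∑ᵛ-distribˡ-* i (2 ^ x r) (λ R → 2 ^ alive e w ps R))) ⟩
      sum {C} (λ r → 2 ^ x r * S)
        ≡⟨ *-distribʳ-sum {C} S (λ r → 2 ^ x r) ⟨
      sum {C} (λ r → 2 ^ x r) * S
        ≤⟨ *-mono-≤ item (expected-2^alive e w ps) ⟩
      (if uses I e p then C + (C ∸ h * L) else C) * gain e w ps ∎
      where
      open ≤-Reasoning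
      x : Fin C → ℕ
      x r = ⟦ uses I e p ∧ survives h r ⟧
      S = ∑ᵛ C i (λ R → 2 ^ alive e w ps R)
      item : sum {C} (λ r → 2 ^ ⟦ uses I e p ∧ survives h r ⟧) ≤ (if uses I e p then C + (C ∸ h * L) else C)
      item with uses I e p
      ... | true  = sum-above C (h * L)
      ... | false = ≤-reflexive (trans (sum-const C 1) (*-identityʳ C))

    -- `E` is D - 1, spelled so that `suc E` and `D` agree by computation.
    D E : ℕ
    D = 2 * C
    E = c + 1 * C

    -- Without denominators cleared: gain ≤ C ^ i · 2^count · (1 - 1/D)^(weight · L). A request in
    -- play with a = h L has factor C · 2 (1 - a/D) ≤ C · 2 (1 - 1/D)^a; one out of play has factor
    -- C.
    gain-bound : ∀ {i} e (w : Vec ℕ i) ps →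
      gain e w ps * (D ^ (weight e w ps * L) * C ^ count e w ps)
        ≤ C ^ i * (D ^ count e w ps * E ^ (weight e w ps * L))
    gain-bound e []      []       = ≤-refl
    gain-bound {suc i} e (h ∷ w) (p ∷ ps) = begin
      γ * G * (D ^ ((v + V) * L) * C ^ (κ + K))
        ≡⟨ cong₂ (λ a b → γ * G * (a * b)) (split D) (^-distribˡ-+-* C κ K) ⟩
      γ * G * (D ^ (v * L) * D ^ (V * L) * (C ^ κ * C ^ K))
        ≡⟨ arrange₁ γ G (D ^ (v * L)) (D ^ (V * L)) (C ^ κ) (C ^ K) ⟩
      γ * (D ^ (v * L) * C ^ κ) * (G * (D ^ (V * L) * C ^ K))
        ≤⟨ *-mono-≤ item (gain-bound e w ps) ⟩
      C * (D ^ κ * E ^ (v * L)) * (C ^ i * (D ^ K * E ^ (V * L)))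
        ≡⟨ arrange₂ C (D ^ κ) (E ^ (v * L)) (C ^ i) (D ^ K) (E ^ (V * L)) ⟩
      C * C ^ i * (D ^ κ * D ^ K * (E ^ (v * L) * E ^ (V * L)))
        ≡⟨ cong₂ (λ a b → C * C ^ i * (a * b)) (^-distribˡ-+-* D κ K) (split E) ⟨
      C * C ^ i * (D ^ (κ + K) * E ^ ((v + V) * L)) ∎
      where
      open ≤-Reasoning
      γ = if uses I e p then C + (C ∸ h * L) else C
      G = gain e w ps
      v = if member e h p then h else 0
      V = weight e w ps
      κ = ⟦ member e h p ⟧
      K = count e w ps
      split : ∀ x → x ^ ((v + V) * L) ≡ x ^ (v * L) * x ^ (V * L)
      split x = trans (cong (x ^_) (*-distribʳ-+ L v V)) (^-distribˡ-+-* x (v * L) (V * L))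
      arrange₁ : ∀ a b c d e f → a * b * (c * d * (e * f)) ≡ a * (c * e) * (b * (d * f))
      arrange₁ = solve-∀
      arrange₂ : ∀ a b c d e f → a * (b * c) * (d * (e * f)) ≡ a * d * (b * e * (c * f))
      arrange₂ = solve-∀
      item : (if uses I e p then C + (C ∸ h * L) else C)
             * (D ^ ((if member e h p then h else 0) * L) * C ^ ⟦ member e h p ⟧)
           ≤ C * (D ^ ⟦ member e h p ⟧ * E ^ ((if member e h p then h else 0) * L))
      item with uses I e p
      ... | false = ≤-refl
      ... | true with h * L <ᵇ C in eq
      ...   | false = ≤-reflexive (cong (_* 1) (trans (cong (C +_) (m≤n⇒m∸n≡0 (out-of-play h eq))) (+-identityʳ C)))
      ...   | true  = begin
        (C + (C ∸ a)) * (D ^ a * (C * 1))  ≡⟨ cong (_* (D ^ a * (C * 1))) double ⟩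
        (D ∸ a) * (D ^ a * (C * 1))        ≡⟨ pull (D ∸ a) (D ^ a) C ⟩
        C * ((D ∸ a) * D ^ a)              ≤⟨ *-monoʳ-≤ C ([d∸a]*d^a≤d*[d∸1]^a E a) ⟩
        C * (D * E ^ a)                    ≡⟨ cong (λ z → C * (z * E ^ a)) (*-identityʳ D) ⟨
        C * (D * 1 * E ^ a)                ∎
        where
        a = h * L
        pull : ∀ x y C → x * (y * (C * 1)) ≡ C * (x * y)
        pull = solve-∀
        double : C + (C ∸ a) ≡ D ∸ a
        double = trans (sym (+-∸-assoc C (<⇒≤ (in-play h eq)))) (cong (λ z → C + z ∸ a) (sym (+-identityʳ C)))

    -- Every draw is below `C`, so a request out of play never survives.
    alive≤count : ∀ {i} e (w : Vec ℕ i) ps R → alive e w ps R ≤ count e w ps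
    alive≤count e []      []       []      = z≤n
    alive≤count e (h ∷ w) (p ∷ ps) (r ∷ R) = +-mono-≤ item (alive≤count e w ps R)
      where
      item : ⟦ uses I e p ∧ survives h r ⟧ ≤ ⟦ member e h p ⟧
      item with uses I e p
      ... | false = z≤n
      ... | true with h * L <ᵇ C in eq
      ...   | true  with survives h r
      ...     | true  = ≤-refl
      ...     | false = z≤n
      item | true | false with survives h r in sv
      ...     | false = z≤n
      ...     | true  = ⊥-elim (<⇒≱ (toℕ<n r) (≤-trans (out-of-play h eq) (≤ᵇ⇒≤ (h * L) (toℕ r) (subst T (sym sv) tt))))

    -- Let k be the count, κ the capacity, Λ = `suc ℓ` and ν = k + 1 - κ. The slack forces weight ≥
    -- C ν, so the moment of 2 ^ `alive` is at most 2^(k - Λν); Markov's inequality at level 2^κ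
    -- then gives probability at most 2^(ν - 1 - Λν) ≤ 2^(-Λ).
    rarely-crowded : ∀ {i} e (w : Vec ℕ i) ps → C * suc (count e w ps) ≤ C * cap I e + weight e w ps →
      2 ^ suc ℓ * ∑ᵛ C i (crowded e w ps) ≤ C ^ i
    rarely-crowded {i} e w ps slack with cap I e ≤? count e w ps
    -- With fewer requests in play than the capacity, the edge cannot be crowded at all.
    ... | no κ≰k = begin
      2 ^ suc ℓ * ∑ᵛ C i (crowded e w ps)  ≤⟨ *-monoʳ-≤ (2 ^ suc ℓ) (∑ᵛ-mono i empty) ⟩
      2 ^ suc ℓ * ∑ᵛ C i (λ _ → 0)         ≡⟨ cong (2 ^ suc ℓ *_) (trans (∑ᵛ-const i 0) (*-zeroʳ (C ^ i))) ⟩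
      2 ^ suc ℓ * 0                        ≡⟨ *-zeroʳ (2 ^ suc ℓ) ⟩
      0                                    ≤⟨ z≤n ⟩
      C ^ i                                ∎
      where
      open ≤-Reasoning
      empty : ∀ R → crowded e w ps R ≤ 0
      empty R with cap I e ≤ᵇ alive e w ps R in eq
      ... | false = z≤n
      ... | true  = ⊥-elim (κ≰k (≤-trans (≤ᵇ⇒≤ (cap I e) _ (subst T (sym eq) tt)) (alive≤count e w ps R)))
    ... | yes κ≤k = *-cancelˡ-≤ (2 ^ κ * 2 ^ k) {{m*n≢0 _ _ {{m^n≢0 2 κ}} {{m^n≢0 2 k}}}} (begin
      2 ^ κ * 2 ^ k * (2 ^ Λ * S)      ≡⟨ arrange₁ (2 ^ κ) (2 ^ k) (2 ^ Λ) S ⟩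
      2 ^ Λ * 2 ^ k * (2 ^ κ * S)      ≤⟨ *-monoʳ-≤ (2 ^ Λ * 2 ^ k) markov ⟩
      2 ^ Λ * 2 ^ k * g                ≡⟨ cong (_* g) (^-distribˡ-+-* 2 Λ k) ⟨
      2 ^ (Λ + k) * g                  ≤⟨ *-monoˡ-≤ g (^-monoʳ-≤ 2 exponent) ⟩
      2 ^ (Λ * ν + κ) * g              ≡⟨ cong (_* g) (^-distribˡ-+-* 2 (Λ * ν) κ) ⟩
      2 ^ (Λ * ν) * 2 ^ κ * g          ≡⟨ arrange₂ (2 ^ (Λ * ν)) (2 ^ κ) g ⟩
      2 ^ κ * (g * 2 ^ (Λ * ν))        ≤⟨ *-monoʳ-≤ (2 ^ κ) product ⟩
      2 ^ κ * (C ^ i * 2 ^ k)          ≡⟨ arrange₃ (2 ^ κ) (C ^ i) (2 ^ k) ⟩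
      2 ^ κ * 2 ^ k * C ^ i            ∎)
      where
      open ≤-Reasoning
      κ = cap I e
      k = count e w ps
      Λ = suc ℓ
      q = k ∸ κ
      ν = suc q
      g = gain e w ps
      S = ∑ᵛ C i (crowded e w ps)
      A = weight e w ps * L
      arrange₁ : ∀ a b c d → a * b * (c * d) ≡ c * b * (a * d)
      arrange₁ = solve-∀
      arrange₂ : ∀ a b c → a * b * c ≡ b * (c * a)
      arrange₂ = solve-∀
      arrange₃ : ∀ a b c → a * (b * c) ≡ a * c * b
      arrange₃ = solve-∀
      markov : 2 ^ κ * S ≤ g
      markov = begin
        2 ^ κ * S                                   ≡⟨ ∑ᵛ-distribˡ-* i (2 ^ κ) (crowded e w ps) ⟨
        ∑ᵛ C i (λ R → 2 ^ κ * crowded e w ps R)     ≤⟨ ∑ᵛ-mono i pointwise ⟩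
        ∑ᵛ C i (λ R → 2 ^ alive e w ps R)           ≤⟨ expected-2^alive e w ps ⟩
        g                                           ∎
        where
        pointwise : ∀ R → 2 ^ κ * crowded e w ps R ≤ 2 ^ alive e w ps R
        pointwise R with κ ≤ᵇ alive e w ps R in eq
        ... | false = ≤-trans (≤-reflexive (*-zeroʳ (2 ^ κ))) z≤n
        ... | true  = ≤-trans (≤-reflexive (*-identityʳ (2 ^ κ))) (^-monoʳ-≤ 2 (≤ᵇ⇒≤ κ (alive e w ps R) (subst T (sym eq) tt)))
      k≡ : suc k ≡ κ + ν
      k≡ = trans (cong suc (sym (m+[n∸m]≡n κ≤k))) (sym (+-suc κ q))
      heavy : C * ν ≤ weight e w ps
      heavy = +-cancelˡ-≤ (C * κ) _ _ (begin
        C * κ + C * ν              ≡⟨ *-distribˡ-+ C κ ν ⟨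
        C * (κ + ν)                ≡⟨ cong (C *_) k≡ ⟨
        C * suc k                  ≤⟨ slack ⟩
        C * κ + weight e w ps      ∎)
      enough : Λ * ν * D ≤ A
      enough = ≤-trans (≤-reflexive (regroup Λ ν C)) (*-monoˡ-≤ L heavy)
        where
        regroup : ∀ l n C → l * n * (2 * C) ≡ C * n * (2 * l)
        regroup = solve-∀
      -- Equivalent to q ≤ Λ q, which holds as Λ ≥ 1.
      exponent : Λ + k ≤ Λ * ν + κ
      exponent = begin
        Λ + k                ≡⟨ cong (Λ +_) (m+[n∸m]≡n κ≤k) ⟨
        Λ + (κ + q)          ≤⟨ +-monoʳ-≤ Λ (+-monoʳ-≤ κ (m≤n*m q Λ)) ⟩
        Λ + (κ + Λ * q)      ≡⟨ regroup Λ κ q ⟩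
        Λ * suc q + κ        ∎
        where
        regroup : ∀ l κ q → l + (κ + l * q) ≡ l * suc q + κ
        regroup = solve-∀
      instance
        E≢0 : NonZero E
        E≢0 = >-nonZero (≤-trans (s≤s z≤n) (≤-trans (m≤m+n C 0) (m≤n+m (C + 0) c)))
      product : g * 2 ^ (Λ * ν) ≤ C ^ i * 2 ^ k
      product = *-cancelʳ-≤ _ _ (E ^ A * C ^ k) {{m*n≢0 _ _ {{m^n≢0 E A}} {{m^n≢0 C k}}}} (begin
        g * 2 ^ (Λ * ν) * (E ^ A * C ^ k)    ≡⟨ regroup₁ g (2 ^ (Λ * ν)) (E ^ A) (C ^ k) ⟩
        g * (2 ^ (Λ * ν) * E ^ A * C ^ k)    ≤⟨ *-monoʳ-≤ g (*-monoˡ-≤ (C ^ k) (2^q*n^x≤[1+n]^x (Λ * ν) enough)) ⟩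
        g * (D ^ A * C ^ k)                  ≤⟨ gain-bound e w ps ⟩
        C ^ i * (D ^ k * E ^ A)              ≡⟨ cong (λ z → C ^ i * (z * E ^ A)) (^-distribʳ-* 2 C k) ⟩
        C ^ i * (2 ^ k * C ^ k * E ^ A)      ≡⟨ regroup₂ (C ^ i) (2 ^ k) (C ^ k) (E ^ A) ⟩
        C ^ i * 2 ^ k * (E ^ A * C ^ k)      ∎)
        where
        regroup₁ : ∀ a b c d → a * b * (c * d) ≡ a * (b * c * d)
        regroup₁ = solve-∀
        regroup₂ : ∀ a b c d → a * (b * c * d) ≡ a * b * (d * c)
        regroup₂ = solve-∀

    rare-failure : ∀ {i} {w : Vec ℕ i} {ps p} (d : Dec (Overloaded w ps p)) →
      2 ^ suc ℓ * ∑ᵛ C i (failure d) ≤ C ^ i * sum (λ e → risk e ps p)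
    rare-failure {i} (yes _) = ≤-trans (≤-reflexive (trans (cong (2 ^ suc ℓ *_) (trans (∑ᵛ-const i 0) (*-zeroʳ (C ^ i)))) (*-zeroʳ (2 ^ suc ℓ)))) z≤n
    rare-failure {i} {w} {ps} {p} (no ¬over) = begin
      a * ∑ᵛ C i (λ R → sum (λ e → risk e ps p * crowded e w ps R))
        ≡⟨ cong (a *_) (trans (∑ᵛ-sum i (λ e R → risk e ps p * crowded e w ps R)) (sum-cong-≗ (λ e → ∑ᵛ-distribˡ-* i (risk e ps p) (crowded e w ps)))) ⟩
      a * sum (λ e → risk e ps p * ∑ᵛ C i (crowded e w ps))
        ≡⟨ *-distribˡ-sum {m I} a (λ e → risk e ps p * ∑ᵛ C i (crowded e w ps)) ⟩
      sum (λ e → a * (risk e ps p * ∑ᵛ C i (crowded e w ps)))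
        ≤⟨ sum-mono item ⟩
      sum (λ e → C ^ i * risk e ps p)
        ≡⟨ *-distribˡ-sum {m I} (C ^ i) (λ e → risk e ps p) ⟨
      C ^ i * sum (λ e → risk e ps p) ∎
      where
      open ≤-Reasoning
      a = 2 ^ suc ℓ
      item : ∀ e → a * (risk e ps p * ∑ᵛ C i (crowded e w ps)) ≤ C ^ i * risk e ps p
      item e with uses I e p in used
      ... | false = ≤-trans (≤-reflexive (*-zeroʳ a)) z≤n
      ... | true with cap I e ≤ᵇ arrivals e ps
      ...   | false = ≤-trans (≤-reflexive (*-zeroʳ a)) z≤n
      ...   | true  = begin
        a * (1 * ∑ᵛ C i (crowded e w ps)) ≡⟨ cong (a *_) (*-identityˡ _) ⟩
        a * ∑ᵛ C i (crowded e w ps)       ≤⟨ rarely-crowded e w ps (≮⇒≥ (λ lt → ¬over (overload e used lt))) ⟩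
        C ^ i                             ≡⟨ *-identityʳ (C ^ i) ⟨
        C ^ i * 1                         ∎

    -- Charging risky arrivals to the optimum.

    risks : ∀ {i} → Fin (m I) → Vec (Path I) i → List (Path I) → ℕ
    risks e ps []       = 0
    risks e ps (p ∷ rs) = risk e ps p + risks e (ps ∷ʳ p) rs

    arrivals-∷ʳ : ∀ {i} e (ps : Vec (Path I) i) p → arrivals e (ps ∷ʳ p) ≡ arrivals e ps + ⟦ uses I e p ⟧
    arrivals-∷ʳ e []        p = +-identityʳ _
    arrivals-∷ʳ e (p′ ∷ ps) p = trans (cong (⟦ uses I e p′ ⟧ +_) (arrivals-∷ʳ e ps p)) (sym (+-assoc ⟦ uses I e p′ ⟧ _ _))

    arrivals≤load+rejected : ∀ {i} e (os : Vec Bool i) ps → arrivals e ps ≤ load I os ps e + rejected os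
    arrivals≤load+rejected e []       []       = z≤n
    arrivals≤load+rejected e (true ∷ os) (p ∷ ps) =
      ≤-trans (+-monoʳ-≤ ⟦ uses I e p ⟧ (arrivals≤load+rejected e os ps)) (≤-reflexive (sym (+-assoc ⟦ uses I e p ⟧ _ _)))
    arrivals≤load+rejected e (false ∷ os) (p ∷ ps) = begin
      ⟦ uses I e p ⟧ + arrivals e ps         ≤⟨ +-mono-≤ (small (uses I e p)) (arrivals≤load+rejected e os ps) ⟩
      suc (load I os ps e + rejected os)     ≡⟨ +-suc (load I os ps e) _ ⟨
      load I os ps e + suc (rejected os)     ∎
      where
      open ≤-Reasoning
      small : ∀ b → ⟦ b ⟧ ≤ 1
      small true  = ≤-refl
      small false = z≤n

    -- A risky arrival finds the capacity already reached, so it raises the truncated difference by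
    -- a full unit.
    risk-excess : ∀ {i} e (ps : Vec (Path I) i) p →
      risk e ps p + (arrivals e ps ∸ cap I e) ≤ arrivals e (ps ∷ʳ p) ∸ cap I e
    risk-excess e ps p rewrite arrivals-∷ʳ e ps p with uses I e p
    ... | false = ≤-reflexive (cong (_∸ cap I e) (sym (+-identityʳ (arrivals e ps))))
    ... | true  with cap I e ≤ᵇ arrivals e ps in eq
    ...   | false = ∸-monoˡ-≤ (cap I e) (m≤m+n (arrivals e ps) 1)
    ...   | true  = ≤-reflexive (trans (sym (+-∸-assoc 1 (≤ᵇ⇒≤ (cap I e) (arrivals e ps) (subst T (sym eq) tt)))) (cong (_∸ cap I e) (+-comm 1 (arrivals e ps))))

    -- The excess of arrivals over the capacity grows with every risky arrival, and its final value
    -- is at most the number of requests that the optimum rejects.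
    risks-bound : ∀ {i} e {ps : Vec (Path I) i} {past} rs future → FeasibleSplit past ps future (fromList rs) →
      risks e ps rs + (arrivals e ps ∸ cap I e) ≤ rejected past + rejected future
    risks-bound e {ps} {past} [] [] feas = ≤-trans (m≤n+o⇒m∸n≤o (arrivals e ps) (cap I e) (≤-trans (arrivals≤load+rejected e past ps)
      (+-monoˡ-≤ (rejected past) (≤-trans (m≤m+n _ 0) (feas e))))) (m≤m+n _ 0)
    risks-bound e {ps} {past} (p ∷ rs) (o ∷ future) feas = begin
      risk e ps p + risks e (ps ∷ʳ p) rs + (arrivals e ps ∸ cap I e)
        ≡⟨ swap (risk e ps p) (risks e (ps ∷ʳ p) rs) _ ⟩
      risks e (ps ∷ʳ p) rs + (risk e ps p + (arrivals e ps ∸ cap I e))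
        ≤⟨ +-monoʳ-≤ (risks e (ps ∷ʳ p) rs) (risk-excess e ps p) ⟩
      risks e (ps ∷ʳ p) rs + (arrivals e (ps ∷ʳ p) ∸ cap I e)
        ≤⟨ risks-bound e {past = past ∷ʳ o} rs future (shift-split {past = past} {o = o} {p = p} {future = future} feas) ⟩
      rejected (past ∷ʳ o) + rejected future
        ≡⟨ rejected-shift past o future ⟩
      rejected past + rejected (o ∷ future) ∎
      where
      open ≤-Reasoning
      swap : ∀ a b c → a + b + c ≡ b + (a + c)
      swap = solve-∀

    -- Number of requests beaten by their threshold at the end plus the number of failures,
    -- summed over all outcomes of the draws still to come.
    costBound : ∀ {i} → Vec ℕ i → Vec (Fin C) i → Vec (Path I) i → List (Path I) → ℕ
    costBound w R ps []       = killed w R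
    costBound w R ps (p ∷ rs) = sum (λ r → costBound (next d) (R ∷ʳ r) (ps ∷ʳ p) rs) + C ^ suc (length rs) * failure d R
      where d = overloaded? w ps p

    module _ (cap≤C : ∀ e → cap I e ≤ C) where
      -- Induction over the remaining requests from any balanced state: `total-next` pays for the
      -- weight added now and `rare-failure` for a failure now. The factors 2 ^ `suc ℓ` and C clear
      -- the failure probability and the kill probability h L / C.
      expected-costBound : ∀ {i} (w : Vec ℕ i) ps rs → Balanced w ps →
        2 ^ suc ℓ * (C * ∑ᵛ C i (λ R → costBound w R ps rs))
          ≤ C ^ (i + length rs) * (2 ^ suc ℓ * (L * (total w ps + 4 * C * augmentations w ps rs)) + C * sum (λ e → risks e ps rs))
      expected-costBound {i} w ps [] bal = begin
        a * (C * ∑ᵛ C i (killed w))                  ≤⟨ *-monoʳ-≤ a (expected-killed w ps) ⟩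
        a * (C ^ i * (L * total w ps))               ≡⟨ *-swap a (C ^ i) (L * total w ps) ⟩
        C ^ i * (a * (L * total w ps))               ≡⟨ cong₂ (λ x y → C ^ x * (a * (L * y))) (+-identityʳ i)
                                                           (trans (cong (total w ps +_) (*-zeroʳ (4 * C))) (+-identityʳ (total w ps))) ⟨
        C ^ (i + 0) * (a * (L * (total w ps + 4 * C * 0)))                ≤⟨ *-monoʳ-≤ (C ^ (i + 0)) (m≤m+n _ _) ⟩
        C ^ (i + 0) * (a * (L * (total w ps + 4 * C * 0)) + C * sum (λ e → risks e ps [])) ∎
        where
        open ≤-Reasoning
        a = 2 ^ suc ℓ
      expected-costBound {i} w ps (p ∷ rs) bal = begin
        a * (C * ∑ᵛ C i (λ R → costBound w R ps (p ∷ rs)))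
          -- The draw of the arriving request joins the past draws, which makes the induction
          -- hypothesis applicable at `suc i`.
          ≡⟨ cong (λ z → a * (C * z)) (trans (∑ᵛ-distrib-+ i (λ R → sum (λ r → costBound (next d) (R ∷ʳ r) (ps ∷ʳ p) rs)) (λ R → C ^ suc j * failure d R)) (cong₂ _+_
               (sym (∑ᵛ-∷ʳ i (λ R → costBound (next d) R (ps ∷ʳ p) rs))) (∑ᵛ-distribˡ-* i (C ^ suc j) (failure d)))) ⟩
        a * (C * (B + C ^ suc j * F))
          ≡⟨ distribute a C B (C ^ suc j) F ⟩
        a * (C * B) + C ^ suc j * (C * (a * F))
          ≤⟨ +-mono-≤ (expected-costBound (next d) (ps ∷ʳ p) rs (balanced-next d bal))
               (*-monoʳ-≤ (C ^ suc j) (*-monoʳ-≤ C (rare-failure d))) ⟩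
        C ^ suc (i + j) * (a * (L * (total (next d) (ps ∷ʳ p) + 4 * C * N)) + C * Y) + C ^ suc j * (C * (C ^ i * X))
          ≤⟨ +-monoˡ-≤ _ (*-monoʳ-≤ (C ^ suc (i + j)) (+-monoˡ-≤ (C * Y) (*-monoʳ-≤ a (*-monoʳ-≤ L
               (+-monoˡ-≤ (4 * C * N) (total-next cap≤C d bal)))))) ⟩
        C ^ suc (i + j) * (a * (L * (total w ps + 4 * C * augmented d + 4 * C * N)) + C * Y) + C ^ suc j * (C * (C ^ i * X))
          ≡⟨ cong (C ^ suc (i + j) * (a * (L * (total w ps + 4 * C * augmented d + 4 * C * N)) + C * Y) +_) powers ⟩
        C ^ suc (i + j) * (a * (L * (total w ps + 4 * C * augmented d + 4 * C * N)) + C * Y) + C ^ suc (i + j) * (C * X)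
          ≡⟨ collect (C ^ suc (i + j)) a L (total w ps) (4 * C) (augmented d) N C X Y ⟩
        C ^ suc (i + j) * (a * (L * (total w ps + 4 * C * (augmented d + N))) + C * (X + Y))
          ≡⟨ cong₂ (λ x y → C ^ x * (a * (L * (total w ps + 4 * C * (augmented d + N))) + C * y))
               (+-suc i j) (∑-distrib-+ {m I} (λ e → risk e ps p) (λ e → risks e (ps ∷ʳ p) rs)) ⟨
        C ^ (i + suc j) * (a * (L * (total w ps + 4 * C * (augmented d + N))) + C * sum (λ e → risks e ps (p ∷ rs))) ∎
        where
        open ≤-Reasoning
        a = 2 ^ suc ℓ
        j = length rs
        d = overloaded? w ps p
        B = ∑ᵛ C (suc i) (λ R → costBound (next d) R (ps ∷ʳ p) rs)
        F = ∑ᵛ C i (failure d)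
        N = augmentations (next d) (ps ∷ʳ p) rs
        X = sum (λ e → risk e ps p)
        Y = sum (λ e → risks e (ps ∷ʳ p) rs)
        distribute : ∀ a C B y F → a * (C * (B + y * F)) ≡ a * (C * B) + y * (C * (a * F))
        distribute = solve-∀
        collect : ∀ z a L t D u N C X Y →
          z * (a * (L * (t + D * u + D * N)) + C * Y) + z * (C * X) ≡ z * (a * (L * (t + D * (u + N))) + C * (X + Y))
        collect = solve-∀
        powers : C ^ suc j * (C * (C ^ i * X)) ≡ C ^ suc (i + j) * (C * X)
        powers = trans (regroup (C ^ j) C (C ^ i) X) (cong (λ z → C * z * (C * X)) (sym (^-distribˡ-+-* C i j)))
          where
          regroup : ∀ y C z X → C * y * (C * (z * X)) ≡ C * (z * y) * (C * X)
          regroup = solve-∀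

  -- The online algorithm

  whole : ℕ → ℚ
  whole k = mkℚ (ℤ.+ k) 0 (Coprimality.sym (Coprimality.1-coprimeTo k))

  -- `toℚ` normalises by a gcd that does not reduce on a variable; `whole` is in lowest terms by
  -- construction, so arithmetic on it computes.
  toℚ≡whole : ∀ k → toℚ k ≡ whole k
  toℚ≡whole k = ℚ.↥p/↧p≡p (whole k)

  toℚ-+ : ∀ a b → toℚ a ℚ.+ toℚ b ≡ toℚ (a + b)
  toℚ-+ a b rewrite toℚ≡whole a | toℚ≡whole b = cong (ℚ._/ 1) (cong₂ ℤ._+_ (ℤ.*-identityʳ (ℤ.+ a)) (ℤ.*-identityʳ (ℤ.+ b)))

  toℚ-* : ∀ a b → toℚ a ℚ.* toℚ b ≡ toℚ (a * b)
  toℚ-* a b rewrite toℚ≡whole a | toℚ≡whole b = cong (ℚ._/ 1) (sym (ℤ.pos-* a b))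

  toℚ-mono : ∀ {a b} → a ≤ b → toℚ a ℚ.≤ toℚ b
  toℚ-mono {a} {b} a≤b rewrite toℚ≡whole a | toℚ≡whole b =
    ℚ.*≤* (subst₂ ℤ._≤_ (sym (ℤ.*-identityʳ (ℤ.+ a))) (sym (ℤ.*-identityʳ (ℤ.+ b))) (ℤ.+≤+ a≤b))

  toℚ-pos : ∀ k .{{_ : NonZero k}} → ℚ.Positive (toℚ k)
  toℚ-pos k@(suc _) = subst ℚ.Positive (sym (toℚ≡whole k)) _

  unit-fraction : ∀ c → (ℤ.+ 1 ℚ./ suc c) ℚ.* toℚ (suc c) ≡ 1ℚ
  unit-fraction c = trans (cong₂ ℚ._*_ (ℚ.↥p/↧p≡p (ℚ.1/ whole (suc c))) (toℚ≡whole (suc c))) (ℚ.*-inverseˡ (whole (suc c)))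

  sumFin-scale : ∀ k (f : Fin k → ℚ) (g : Fin k → ℕ) a → (∀ j → f j ℚ.* a ℚ.≤ toℚ (g j)) →
    sumFin k f ℚ.* a ℚ.≤ toℚ (sum g)
  sumFin-scale zero    f g a f≤g = ℚ.≤-reflexive (ℚ.*-zeroˡ a)
  sumFin-scale (suc k) f g a f≤g = begin
    (f zero ℚ.+ sumFin k (λ j → f (suc j))) ℚ.* a             ≡⟨ ℚ.*-distribʳ-+ a (f zero) _ ⟩
    f zero ℚ.* a ℚ.+ sumFin k (λ j → f (suc j)) ℚ.* a         ≤⟨ ℚ.+-mono-≤ (f≤g zero) (sumFin-scale k _ _ a (λ j → f≤g (suc j))) ⟩
    toℚ (g zero) ℚ.+ toℚ (sum (λ j → g (suc j)))              ≡⟨ toℚ-+ (g zero) _ ⟩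
    toℚ (sum g)                                               ∎
    where open ℚ.≤-Reasoning

  -- The probability 1/C of the current draw cancels one factor of the number of outcomes.
  average : ∀ c x y → x ℚ.* (ℤ.+ 1 ℚ./ suc c) ℚ.* toℚ (suc c * y) ≡ x ℚ.* toℚ y
  average c x y = begin
    x ℚ.* u ℚ.* toℚ (suc c * y)             ≡⟨ cong (x ℚ.* u ℚ.*_) (toℚ-* (suc c) y) ⟨
    x ℚ.* u ℚ.* (toℚ (suc c) ℚ.* toℚ y)     ≡⟨ ℚ.*-assoc x u _ ⟩
    x ℚ.* (u ℚ.* (toℚ (suc c) ℚ.* toℚ y))   ≡⟨ cong (x ℚ.*_) (ℚ.*-assoc u (toℚ (suc c)) (toℚ y)) ⟨
    x ℚ.* (u ℚ.* toℚ (suc c) ℚ.* toℚ y)     ≡⟨ cong (λ z → x ℚ.* (z ℚ.* toℚ y)) (unit-fraction c) ⟩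
    x ℚ.* (1ℚ ℚ.* toℚ y)                    ≡⟨ cong (x ℚ.*_) (ℚ.*-identityˡ (toℚ y)) ⟩
    x ℚ.* toℚ y                             ∎
    where
    open ≡-Reasoning
    u = ℤ.+ 1 ℚ./ suc c

  -- The state type of an `Alg` cannot vary with the number of requests, so vectors are stored as
  -- lists and read back at the required length. Padding and truncation only make this total; stored
  -- vectors come back intact.
  fit : ∀ {A : Set} → A → (i : ℕ) → List A → Vec A i
  fit a zero    xs       = []
  fit a (suc i) []       = a ∷ fit a i []
  fit a (suc i) (x ∷ xs) = x ∷ fit a i xs

  fit-toList : ∀ {A : Set} (a : A) {i} (xs : Vec A i) → fit a i (toList xs) ≡ xs
  fit-toList a []       = refl
  fit-toList a (x ∷ xs) = cong (x ∷_) (fit-toList a xs)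

  -- The preemptive algorithm, its legality and its rejections.

  module Online (I : Instance) (c ℓ : ℕ) where
    open Algorithm I c ℓ
    open Random I c ℓ

    keep : ∀ {i} → Vec Bool i → Vec (Fin C) i → Vec ℕ i → Vec Bool i
    keep []        []      []      = []
    keep (b ∷ acc) (r ∷ R) (h ∷ w) = (b ∧ survives h r) ∷ keep acc R w

    feasible? : ∀ {i} (acc : Vec Bool i) ps → Dec (Feasible I acc ps)
    feasible? acc ps = all? (λ e → load I acc ps e ≤? cap I e)

    accept : ∀ {A B : Set} → Dec A → Dec B → Bool
    accept (no _) (yes _) = true
    accept _      _       = false

    retained : ∀ {i} {w : Vec ℕ i} {ps p} → Dec (Overloaded w ps p) → Vec Bool i → Vec (Fin C) i → Vec Bool i
    retained d acc R = keep acc R (bumped d)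

    verdict : ∀ {i} {w : Vec ℕ i} {ps p} → Dec (Overloaded w ps p) → Vec Bool i → Vec (Fin C) i → Bool
    verdict {ps = ps} {p} d acc R = accept d (feasible? (retained d acc R ∷ʳ true) (ps ∷ʳ p))

    react : ∀ {i} → Vec ℕ i → Vec (Fin C) i → Vec Bool i → Vec (Path I) i → Path I → Fin C →
      (List ℕ × List (Fin C)) × Vec Bool i × Bool
    react w R acc ps p r = (toList (next d) , toList (R ∷ʳ r)) , retained d acc R , verdict d acc R
      where d = overloaded? w ps p

    online : Alg I
    online = record
      { State = List ℕ × List (Fin C)
      ; init  = [] , []
      ; step  = λ i (ws , Rs) acc ps p → c , react (fit 0 i ws) (fit zero i Rs) acc ps p
      }

    load-keep : ∀ {i} (acc : Vec Bool i) R w ps e → load I (keep acc R w) ps e ≤ load I acc ps e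
    load-keep []        []      []      []       e = z≤n
    load-keep (b ∷ acc) (r ∷ R) (h ∷ w) (p ∷ ps) e = +-mono-≤ (item b (survives h r) (uses I e p)) (load-keep acc R w ps e)
      where
      item : ∀ b s u → ⟦ (b ∧ s) ∧ u ⟧ ≤ ⟦ b ∧ u ⟧
      item true  true  u = ≤-refl
      item true  false u = z≤n
      item false s     u = z≤n

    keep-⊆ : ∀ {i} (acc : Vec Bool i) R w → keep acc R w ⊆ᵇ acc
    keep-⊆ (b ∷ acc) (r ∷ R) (h ∷ w) zero    kept = Bool.∧-conicalˡ b (survives h r) kept
    keep-⊆ (b ∷ acc) (r ∷ R) (h ∷ w) (suc j) kept = keep-⊆ acc R w j kept

    feasible-next : ∀ {i} {w : Vec ℕ i} {ps p} (d : Dec (Overloaded w ps p)) acc R →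
      Feasible I acc ps → Feasible I (retained d acc R ∷ʳ verdict d acc R) (ps ∷ʳ p)
    feasible-next {ps = ps} {p} d acc R feas = go d (feasible? (retained d acc R ∷ʳ true) (ps ∷ʳ p))
      where
      rejecting : Feasible I (retained d acc R ∷ʳ false) (ps ∷ʳ p)
      rejecting e = begin
        load I (retained d acc R ∷ʳ false) (ps ∷ʳ p) e   ≡⟨ load-∷ʳ (retained d acc R) ps false p e ⟩
        load I (retained d acc R) ps e + 0               ≡⟨ +-identityʳ _ ⟩
        load I (retained d acc R) ps e                   ≤⟨ load-keep acc R (bumped d) ps e ⟩
        load I acc ps e                                  ≤⟨ feas e ⟩
        cap I e                                          ∎
        where open ≤-Reasoning
      go : ∀ {A : Set} (d′ : Dec A) (f : Dec (Feasible I (retained d acc R ∷ʳ true) (ps ∷ʳ p))) →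
        Feasible I (retained d acc R ∷ʳ accept d′ f) (ps ∷ʳ p)
      go (yes _) _       = rejecting
      go (no _)  (yes f) = f
      go (no _)  (no _)  = rejecting

    -- Legality needs no probability: accepting is preceded by an explicit feasibility test, and
    -- preempting only lowers loads. It therefore holds from any stored state.
    legalFrom : ∀ {i} s acc ps rs → Feasible I acc ps → LegalFrom online i s acc ps rs
    legalFrom s acc ps []       feas = tt
    legalFrom {i} (ws , Rs) acc ps (p ∷ rs) feas r =
      keep-⊆ acc _ (bumped d) , feas′ , legalFrom _ _ _ rs feas′
      where
      d = overloaded? (fit 0 i ws) ps p
      feas′ = feasible-next d acc (fit zero i Rs) feas

    -- Requests rejected only because they did not fit on arrival.
    unexplained : ∀ {i} → Vec Bool i → Vec (Fin C) i → Vec ℕ i → ℕ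
    unexplained []        []      []      = 0
    unexplained (b ∷ acc) (r ∷ R) (h ∷ w) = ⟦ not b ∧ survives h r ⟧ + unexplained acc R w

    unexplained-∷ʳ : ∀ {i} (acc : Vec Bool i) R w b r h →
      unexplained (acc ∷ʳ b) (R ∷ʳ r) (w ∷ʳ h) ≡ unexplained acc R w + ⟦ not b ∧ survives h r ⟧
    unexplained-∷ʳ []         []       []       b r h = +-identityʳ _
    unexplained-∷ʳ (b′ ∷ acc) (r′ ∷ R) (h′ ∷ w) b r h =
      trans (cong (⟦ not b′ ∧ survives h′ r′ ⟧ +_) (unexplained-∷ʳ acc R w b r h)) (sym (+-assoc ⟦ not b′ ∧ survives h′ r′ ⟧ _ _))

    rejected≤killed+unexplained : ∀ {i} (acc : Vec Bool i) R w → rejected acc ≤ killed w R + unexplained acc R w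
    rejected≤killed+unexplained []        []      []      = z≤n
    rejected≤killed+unexplained (b ∷ acc) (r ∷ R) (h ∷ w) = begin
      rejected (b ∷ acc)                    ≡⟨ rejected-∷ b acc ⟩
      ⟦ not b ⟧ + rejected acc              ≤⟨ +-mono-≤ (item b (survives h r)) (rejected≤killed+unexplained acc R w) ⟩
      ⟦ not s ⟧ + ⟦ not b ∧ s ⟧ + (killed w R + unexplained acc R w)
        ≡⟨ +-interchange ⟦ not s ⟧ ⟦ not b ∧ s ⟧ (killed w R) (unexplained acc R w) ⟩
      ⟦ not s ⟧ + killed w R + (⟦ not b ∧ s ⟧ + unexplained acc R w) ∎
      where
      open ≤-Reasoning
      s = survives h r
      item : ∀ b s → ⟦ not b ⟧ ≤ ⟦ not s ⟧ + ⟦ not b ∧ s ⟧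
      item true  s     = z≤n
      item false true  = ≤-refl
      item false false = ≤-refl

    survives-antitone : ∀ {h h′} r → h ≤ h′ → T (survives h′ r) → T (survives h r)
    survives-antitone {h} {h′} r h≤h′ alive′ = ≤⇒≤ᵇ (≤-trans (*-monoˡ-≤ L h≤h′) (≤ᵇ⇒≤ (h′ * L) (toℕ r) alive′))

    -- A preempted request does not survive its new weight, so the preemption is explained. Survival
    -- is antitone in the weight, so raising weights creates no unexplained rejection.
    unexplained-keep : ∀ {i} (acc : Vec Bool i) R w (ps : Vec (Path I) i) (u : ℕ → Path I → ℕ) → (∀ h p → h ≤ u h p) →
      unexplained (keep acc R (zipWith u w ps)) R (zipWith u w ps) ≤ unexplained acc R w
    unexplained-keep []        []      []      []       u h≤u = z≤n
    unexplained-keep (b ∷ acc) (r ∷ R) (h ∷ w) (p ∷ ps) u h≤u =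
      +-mono-≤ (item b _ _ (survives-antitone r (h≤u h p))) (unexplained-keep acc R w ps u h≤u)
      where
      item : ∀ b s′ s → (T s′ → T s) → ⟦ not (b ∧ s′) ∧ s′ ⟧ ≤ ⟦ not b ∧ s ⟧
      item b     false s     f rewrite Bool.∧-zeroʳ b = z≤n
      item true  true  s     f = z≤n
      item false true  true  f = ≤-refl
      item false true  false f = ⊥-elim (f tt)

    load-keep≤alive : ∀ {i} (acc : Vec Bool i) R w ps e → load I (keep acc R w) ps e ≤ alive e w ps R
    load-keep≤alive []        []      []      []       e = z≤n
    load-keep≤alive (b ∷ acc) (r ∷ R) (h ∷ w) (p ∷ ps) e =
      +-mono-≤ (item b (survives h r) (uses I e p)) (load-keep≤alive acc R w ps e)
      where
      item : ∀ b s u → ⟦ (b ∧ s) ∧ u ⟧ ≤ ⟦ u ∧ s ⟧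
      item false s     u     = z≤n
      item true  false u     = z≤n
      item true  true  false = z≤n
      item true  true  true  = ≤-refl

    load≤arrivals : ∀ {i} (acc : Vec Bool i) ps e → load I acc ps e ≤ arrivals e ps
    load≤arrivals []        []       e = z≤n
    load≤arrivals (b ∷ acc) (p ∷ ps) e = +-mono-≤ (item b (uses I e p)) (load≤arrivals acc ps e)
      where
      item : ∀ b u → ⟦ b ∧ u ⟧ ≤ ⟦ u ⟧
      item true  u = ≤-refl
      item false u = z≤n

    survives-C : ∀ r → survives C r ≡ false
    survives-C r with survives C r in eq
    ... | false = refl
    ... | true  = ⊥-elim (<⇒≱ (toℕ<n r) (≤-trans (h≤hL C) (≤ᵇ⇒≤ (C * L) (toℕ r) (subst T (sym eq) tt))))

    zipWith-const-id : ∀ {i} (w : Vec ℕ i) (ps : Vec (Path I) i) → zipWith (λ h _ → h) w ps ≡ w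
    zipWith-const-id []      []       = refl
    zipWith-const-id (h ∷ w) (p ∷ ps) = cong (h ∷_) (zipWith-const-id w ps)

    -- A violated edge must lie on the newcomer, the kept requests being feasible. There the kept
    -- load has reached the capacity, and it is bounded both by `arrivals` and by `alive`, so the
    -- term of that edge equals 1.
    infeasible⇒failure : ∀ {i} {w : Vec ℕ i} {ps p} (¬over : ¬ Overloaded w ps p) acc R → Feasible I acc ps →
      ¬ Feasible I (keep acc R w ∷ʳ true) (ps ∷ʳ p) → 1 ≤ failure (no ¬over) R
    infeasible⇒failure {w = w} {ps} {p} ¬over acc R feas ¬feas
      with ¬∀⟶∃¬ (m I) _ (λ e → load I (keep acc R w ∷ʳ true) (ps ∷ʳ p) e ≤? cap I e) ¬feas
    ... | e , ≰cap = ≤-trans (≤-reflexive (sym item)) (term≤sum (λ e → risk e ps p * crowded e w ps R) e)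
      where
      open ≤-Reasoning
      l = load I (keep acc R w) ps e
      exceeds : cap I e < l + ⟦ uses I e p ⟧
      exceeds = subst (cap I e <_) (load-∷ʳ (keep acc R w) ps true p e) (≰⇒> ≰cap)
      full : uses I e p ≡ true × cap I e ≤ l
      full with uses I e p | exceeds
      ... | true  | lt = refl , s≤s⁻¹ (subst (cap I e <_) (+-comm l 1) lt)
      ... | false | lt = ⊥-elim (<⇒≱ lt (≤-trans (≤-reflexive (+-identityʳ l)) (≤-trans (load-keep acc R w ps e) (feas e))))
      ≤ᵇ-true : ∀ {a b} → a ≤ b → (a ≤ᵇ b) ≡ true
      ≤ᵇ-true a≤b = Bool.T-≡ .Equivalence.to (≤⇒≤ᵇ a≤b)
      item : risk e ps p * crowded e w ps R ≡ 1
      item rewrite proj₁ full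
        | ≤ᵇ-true (≤-trans (proj₂ full) (load≤arrivals (keep acc R w) ps e))
        | ≤ᵇ-true (≤-trans (proj₂ full) (load-keep≤alive acc R w ps e)) = refl

    -- Only the newcomer can become unexplained. If it is rejected by an augmentation, its weight C
    -- survives no draw and it counts as killed; otherwise its rejection is a failure.
    unexplained-next : ∀ {i} {w : Vec ℕ i} {ps p} (d : Dec (Overloaded w ps p)) acc R r → Feasible I acc ps →
      unexplained (retained d acc R ∷ʳ verdict d acc R) (R ∷ʳ r) (next d) ≤ unexplained acc R w + failure d R
    unexplained-next {w = w} {ps} {p} d acc R r feas = begin
      unexplained (retained d acc R ∷ʳ verdict d acc R) (R ∷ʳ r) (next d)
        ≡⟨ unexplained-∷ʳ (retained d acc R) R (bumped d) (verdict d acc R) r (fresh d) ⟩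
      unexplained (retained d acc R) R (bumped d) + ⟦ not (verdict d acc R) ∧ survives (fresh d) r ⟧
        ≤⟨ +-mono-≤ (unexplained-keep acc R w ps (bump d) (bump-≥ d)) (newest d) ⟩
      unexplained acc R w + failure d R ∎
      where
      open ≤-Reasoning
      newest : ∀ (d : Dec (Overloaded w ps p)) → ⟦ not (verdict d acc R) ∧ survives (fresh d) r ⟧ ≤ failure d R
      newest (yes _) rewrite survives-C r = z≤n
      newest (no ¬over) with feasible? (keep acc R (zipWith (λ h _ → h) w ps) ∷ʳ true) (ps ∷ʳ p)
      ... | yes _    = z≤n
      ... | no ¬feas rewrite zipWith-const-id w ps = infeasible⇒failure ¬over acc R feas ¬feas

    expRej-step : ∀ {i} (w : Vec ℕ i) R acc ps p rs → let d = overloaded? w ps p in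
      ExpRejFrom online i (toList w , toList R) acc ps (p ∷ rs)
        ≡ sumFin C (λ r → ExpRejFrom online (suc i) (toList (next d) , toList (R ∷ʳ r))
                            (retained d acc R ∷ʳ verdict d acc R) (ps ∷ʳ p) rs) ℚ.* (ℤ.+ 1 ℚ./ C)
    expRej-step w R acc ps p rs rewrite fit-toList 0 w | fit-toList {A = Fin C} zero R = refl

    -- Multiplying by the number of outcomes of the remaining draws clears every 1/C. A request
    -- already unexplained is charged once in each outcome, hence the factor on `unexplained`.
    expRej-bound : ∀ {i} (w : Vec ℕ i) R acc ps rs → Feasible I acc ps →
      ExpRejFrom online i (toList w , toList R) acc ps rs ℚ.* toℚ (C ^ length rs)
        ℚ.≤ toℚ (costBound w R ps rs + C ^ length rs * unexplained acc R w)
    expRej-bound w R acc ps [] feas = ℚ.≤-trans (ℚ.≤-reflexive (trans (cong (toℚ (rejected acc) ℚ.*_) refl) (ℚ.*-identityʳ _)))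
      (toℚ-mono (≤-trans (rejected≤killed+unexplained acc R w) (≤-reflexive (cong (killed w R +_) (sym (*-identityˡ _))))))
    expRej-bound {i} w R acc ps (p ∷ rs) feas = begin
      ExpRejFrom online i (toList w , toList R) acc ps (p ∷ rs) ℚ.* toℚ (C * y)
        ≡⟨ cong (ℚ._* toℚ (C * y)) (expRej-step w R acc ps p rs) ⟩
      sumFin C X ℚ.* (ℤ.+ 1 ℚ./ C) ℚ.* toℚ (C * y)
        ≡⟨ average c (sumFin C X) y ⟩
      sumFin C X ℚ.* toℚ y
        ≤⟨ sumFin-scale C X (λ r → B r + y * (u + F)) (toℚ y) each ⟩
      toℚ (sum (λ r → B r + y * (u + F)))
        ≡⟨ cong toℚ (trans (∑-distrib-+ {C} B (λ _ → y * (u + F))) (trans (cong (sum B +_) (sum-const C _)) (collect (sum B) C y u F))) ⟩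
      toℚ (sum B + C * y * F + C * y * u) ∎
      where
      open ℚ.≤-Reasoning
      d = overloaded? w ps p
      y = C ^ length rs
      u = unexplained acc R w
      F = failure d R
      X : Fin C → ℚ
      X r = ExpRejFrom online (suc i) (toList (next d) , toList (R ∷ʳ r)) (retained d acc R ∷ʳ verdict d acc R) (ps ∷ʳ p) rs
      B : Fin C → ℕ
      B r = costBound (next d) (R ∷ʳ r) (ps ∷ʳ p) rs
      collect : ∀ b C y u F → b + C * (y * (u + F)) ≡ b + C * y * F + C * y * u
      collect = solve-∀
      each : ∀ r → X r ℚ.* toℚ y ℚ.≤ toℚ (B r + y * (u + F))
      each r = ℚ.≤-trans (expRej-bound (next d) (R ∷ʳ r) _ (ps ∷ʳ p) rs (feasible-next d acc R feas))
        (toℚ-mono (+-monoʳ-≤ (B r) (*-monoʳ-≤ y (unexplained-next d acc R r feas))))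

    -- The competitive ratio.

    module _ (cap≤C : ∀ e → cap I e ≤ C) (m≤2^Λ : m I ≤ 2 ^ suc ℓ) (rs : List (Path I)) (opt : Vec Bool (length rs))
             (feas : Feasible I opt (fromList rs)) where

      N len : ℕ
      N = augmentations [] [] rs
      len = length rs

      costBound≤ : costBound [] [] [] rs ≤ (L * (4 * N) + rejected opt) * C ^ len
      costBound≤ = *-cancelˡ-≤ (a * C) {{m*n≢0 _ _ {{m^n≢0 2 (suc ℓ)}}}} (begin
        a * C * costBound [] [] [] rs                                 ≡⟨ *-assoc a C _ ⟩
        a * (C * costBound [] [] [] rs)                               ≤⟨ expected-costBound cap≤C [] [] rs (λ e → ≤-trans (≤-reflexive (*-zeroʳ C)) z≤n) ⟩
        C ^ len * (a * (L * (4 * C * N)) + C * sum (λ e → risks e [] rs)) ≤⟨ *-monoʳ-≤ (C ^ len) (+-monoʳ-≤ (a * (L * (4 * C * N))) (*-monoʳ-≤ C risky)) ⟩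
        C ^ len * (a * (L * (4 * C * N)) + C * (a * rejected opt))      ≡⟨ collect (C ^ len) a L C N (rejected opt) ⟩
        a * C * ((L * (4 * N) + rejected opt) * C ^ len)                ∎)
        where
        open ≤-Reasoning
        a = 2 ^ suc ℓ
        collect : ∀ y a L C N o → y * (a * (L * (4 * C * N)) + C * (a * o)) ≡ a * C * ((L * (4 * N) + o) * y)
        collect = solve-∀
        -- Each edge has at most as many risky arrivals as the optimum has rejections; the number of
        -- edges is absorbed by the failure probability 2^(-Λ), Λ = `suc ℓ`.
        risky : sum (λ e → risks e [] rs) ≤ a * rejected opt
        risky = begin
          sum (λ e → risks e [] rs)           ≤⟨ sum-mono (λ e → ≤-trans (m≤m+n _ _) (risks-bound e {past = []} rs opt feas)) ⟩
          sum {m I} (λ e → rejected opt)      ≡⟨ sum-const (m I) (rejected opt) ⟩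
          m I * rejected opt                  ≤⟨ *-monoˡ-≤ (rejected opt) m≤2^Λ ⟩
          a * rejected opt                    ∎

      competitive : ExpRej online rs ℚ.≤ toℚ (L * (4 * N) + rejected opt)
      competitive = ℚ.*-cancelʳ-≤-pos (toℚ (C ^ len)) {{toℚ-pos (C ^ len) {{m^n≢0 C len}}}} (begin
        ExpRej online rs ℚ.* toℚ (C ^ len)
          ≤⟨ expRej-bound [] [] [] [] rs (λ e → z≤n) ⟩
        toℚ (costBound [] [] [] rs + C ^ len * 0)
          ≡⟨ cong toℚ (trans (cong (costBound [] [] [] rs +_) (*-zeroʳ (C ^ len))) (+-identityʳ _)) ⟩
        toℚ (costBound [] [] [] rs)
          ≤⟨ toℚ-mono costBound≤ ⟩
        toℚ ((L * (4 * N) + rejected opt) * C ^ len)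
          ≡⟨ toℚ-* (L * (4 * N) + rejected opt) (C ^ len) ⟨
        toℚ (L * (4 * N) + rejected opt) ℚ.* toℚ (C ^ len) ∎)
        where open ℚ.≤-Reasoning

      -- The initial potential is the empty product 1, so `augmentations-bound` compares two powers
      -- of 2.
      augmentations≤ : ∀ k → C ≤ 2 ^ k → N ≤ suc k * rejected opt
      augmentations≤ k C≤2^k = 2^-cancel-≤ (begin
        2 ^ N                             ≡⟨ *-identityʳ (2 ^ N) ⟨
        2 ^ N * 1                         ≤⟨ augmentations-bound {past = []} rs opt [] feas ⟩
        (2 * C) ^ rejected opt            ≤⟨ ^-monoˡ-≤ (rejected opt) (*-monoʳ-≤ 2 C≤2^k) ⟩
        (2 ^ suc k) ^ rejected opt        ≡⟨ ^-*-assoc 2 (suc k) (rejected opt) ⟩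
        2 ^ (suc k * rejected opt)        ∎)
        where
        open ≤-Reasoning
        2^-cancel-≤ : ∀ {a b} → 2 ^ a ≤ 2 ^ b → a ≤ b
        2^-cancel-≤ le = ≮⇒≥ (λ lt → <⇒≱ (^-monoʳ-< 2 (s≤s (s≤s z≤n)) lt) le)

  ∈⇒≤foldr-⊔ : ∀ {x xs} → x ∈ xs → x ≤ foldr _⊔_ 0 xs
  ∈⇒≤foldr-⊔ (here refl)          = m≤m⊔n _ _
  ∈⇒≤foldr-⊔ {xs = y ∷ _} (there x∈) = m≤n⇒m≤o⊔n y (∈⇒≤foldr-⊔ x∈)

  cap≤maxCap : ∀ I e → cap I e ≤ maxCap I
  cap≤maxCap I e = ∈⇒≤foldr-⊔ (∈-map⁺ (cap I) (∈-allFin e))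

  module _ (I : Instance) where
    private
      c ℓ : ℕ
      c = maxCap I
      ℓ = ⌈log₂ m I ⌉

    open Online I c ℓ

    algorithm : Alg I
    algorithm = online

    algorithm-legal : ∀ rs → Legal algorithm rs
    algorithm-legal rs = legalFrom _ [] [] rs (λ _ → z≤n)

    algorithm-competitive : ∀ rs (opt : Vec Bool (length rs)) → Feasible I opt (fromList rs) →
      ExpRej algorithm rs ℚ.≤ toℚ (17 * logFactor I * rejected opt)
    algorithm-competitive rs opt feas = ℚ.≤-trans (competitive cap≤C m≤2^Λ rs opt feas)
      (toℚ-mono (ratio ℓ ⌈log₂ c ⌉ (rejected opt) (augmentations≤ cap≤C m≤2^Λ rs opt feas (suc ⌈log₂ c ⌉) C≤2^k)))
      where
      open ≤-Reasoning
      cap≤C : ∀ e → cap I e ≤ suc c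
      cap≤C e = m≤n⇒m≤1+n (cap≤maxCap I e)
      m≤2^Λ : m I ≤ 2 ^ suc ℓ
      m≤2^Λ = ≤-trans (n≤2^⌈log₂n⌉ (m I)) (m≤n*m (2 ^ ℓ) 2)
      C≤2^k : suc c ≤ 2 ^ suc ⌈log₂ c ⌉
      C≤2^k = ≤-trans (+-mono-≤ (m^n>0 2 ⌈log₂ c ⌉) (n≤2^⌈log₂n⌉ c)) (≤-reflexive (cong (2 ^ ⌈log₂ c ⌉ +_) (sym (+-identityʳ _))))
      -- Since k + 2 ≤ 2 (k + 1), the augmentations cost at most 16 (ℓ + 1)(k + 1) o; the failures
      -- cost o, at most (ℓ + 1)(k + 1) o more, which makes 17.
      ratio : ∀ ℓ k o {N} → N ≤ suc (suc k) * o → 2 * suc ℓ * (4 * N) + o ≤ 17 * (suc ℓ * suc k) * o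
      ratio ℓ k o {N} N≤ = begin
        2 * suc ℓ * (4 * N) + o
          ≤⟨ +-mono-≤ (*-monoʳ-≤ (2 * suc ℓ) (*-monoʳ-≤ 4 (≤-trans N≤ (*-monoˡ-≤ o (m≤m+n (suc (suc k)) k))))) (m≤m+n o _) ⟩
        2 * suc ℓ * (4 * ((suc (suc k) + k) * o)) + (o + (ℓ + k + ℓ * k) * o)
          ≡⟨ collect ℓ k o ⟩
        17 * (suc ℓ * suc k) * o ∎
        where
        collect : ∀ l k o → 2 * suc l * (4 * ((suc (suc k) + k) * o)) + (o + (l + k + l * k) * o) ≡ 17 * (suc l * suc k) * o
        collect = solve-∀

open Rejections
open import Data.Rational using (_≤_)

theorem3 : Σ ℕ λ K → (I : Instance) → Σ (Alg I) λ A →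
    (rs : List (Path I)) → All (IsSimplePath I) rs →
    Legal A rs ×
    ((opt : Vec Bool (length rs)) → Feasible I opt (fromList rs) →
    ExpRej A rs ≤ toℚ (K * logFactor I * rejected opt))
theorem3 = 17 , λ I → algorithm I , λ rs _ → algorithm-legal I rs , algorithm-competitive I rs
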